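{- The psi-calculus $\mathbf{SORTEDPPI}$ is a complete representation of the sorted polyadic pi-calculus.
   Context: **Names, nominal sets.** $\mathrm S$ is a countable set of subject sorts; for each $s\in\mathrm S$ there is a countably infinite set $\mathcal N_s$ of names of sort $s$, pairwise disjoint; $\mathcal N=\bigcup_s\mathcal N_s$. $\mathtt{ob}:\mathrm S\rightharpoonup\mathrm S^*$ is a partial function. A tilde denotes a finite tuple (or the set of its entries). $\mathrm n(T)$ is the (finite) support of $T$, i.e. its free names; $a\#T$ means $a\notin\mathrm n(T)$. Swappings, alpha-conversion and substitution preserve sorts of names. Equivariant means preserved by all such swappings. **The sorted psi-calculus SORTEDPPI.** Sorts: $\mathcal S=\mathrm S\cup\{\langle\tilde s\rangle:\tilde s\in\mathrm S^*\}$. Terms: $\mathbf T=\mathcal N\cup\{\langle\tilde a\rangle:\tilde a\in\mathcal N^*\}$, with $\mathrm{SORT}(\langle a_1,\dots,a_n\rangle)=\langle\mathrm{SORT}(a_1),\dots,\mathrm{SORT}(a_n)\rangle$. Conditions: $\mathbf C=\{\top,\bot\}\cup\{a=b:a,b\in\mathcal N\}$. Assertions: $\mathbf A=\{\mathbf 1\}$, $\mathbf 1\otimes\mathbf 1=\mathbf 1$. Entailment: $\mathbf 1\vdash\top$; $\mathbf 1\vdash a=b$ iff $a$ and $b$ are the same name; $\mathbf 1\not\vdash\bot$. Channel equivalence: $a\leftrightarrow b$ is the condition $a=b$ for names, and $M\leftrightarrow N$ is $\bot$ if $M,N$ are not both names. Patterns: $\mathbf X=\{\langle\tilde a\rangle:\tilde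 a\in\mathcal N^*\text{ with distinct entries}\}$, sorted as tuples; $\mathrm{vars}(\langle\tilde a\rangle)=\{\tilde a\}$. $\mathrm{Match}(\langle\tilde a\rangle,\tilde x,\langle\tilde y\rangle)=\{\pi\cdot\tilde a\}$ if $\tilde x=\pi\cdot\tilde y$ for a permutation $\pi$ of tuple positions and $\mathrm{SORT}(\langle\tilde a\rangle)=\mathrm{SORT}(\langle\tilde y\rangle)$; $\mathrm{Match}$ is $\emptyset$ otherwise. Only names can be substituted for names, and only of the same sort; substitution is the usual simultaneous one (patterns are unaffected, all their names being bound). All names may be restricted. A term of sort $s$ can send terms of, and receive with patterns of, sort $t$ iff $s\in\mathrm{dom}(\mathtt{ob})$ and $t=\langle\mathtt{ob}(s)\rangle$. **Agents.** $\overline M\,N.P$ (well-formed only if $M$ is a name of some sort $s$ and $\mathrm{SORT}(N)=\langle\mathtt{ob}(s)\rangle$); $\underline M(\lambda\tilde x)X.P$ (well-formed only if $M$ is a name of some sort $s$, $\mathrm{SORT}(X)=\langle\mathtt{ob}(s)\rangle$ and $\tilde x$ is a tuple of distinct names listing exactly the names of $X$; $\tilde x$ binds in $X$ and $P$); $\mathbf{case}\ \varphi_1:P_1[]\cdots[]\varphi_n:P_n$ (the empty case is $\mathbf 0$); $(\nu a)P$; $P\mid Q$; $!P$; $(\!|\Psi|\!)$. Agents are identified up to alpha-equivalence. An assertion is unguarded if not inside an input or output; well-formed agents must have no unguarded assertions inside the body of a replication or inside a branch of a case. Only well-formed agents are considered. Substitution on agents is capture-avoiding. **Transitions of SORTEDPPI**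 (the only assertion being $\mathbf 1$, it is omitted). Actions: $\overline M(\nu\tilde a)N$ with $\tilde a\subseteq\mathrm n(N)$ (bound names $\tilde a$; written $\overline M\,N$ if $\tilde a$ is empty), $\underline M\,N$, $\tau$. Bound names bind into object and derivative. - In: $\underline M(\lambda\tilde y)X.P\xrightarrow{\underline K\,N}P[\tilde y:=\tilde L]$ if $\mathbf 1\vdash M\leftrightarrow K$ and $\tilde L\in\mathrm{Match}(N,\tilde y,X)$. - Out: $\overline M\,N.P\xrightarrow{\overline K\,N}P$ if $\mathbf 1\vdash M\leftrightarrow K$. - Com: if $P\xrightarrow{\overline M(\nu\tilde a)N}P'$, $Q\xrightarrow{\underline K\,N}Q'$, $\mathbf 1\vdash M\leftrightarrow K$, $\tilde a\#Q$, then $P\mid Q\xrightarrow\tau(\nu\tilde a)(P'\mid Q')$ (and symmetrically). - Par: if $P\xrightarrow\alpha P'$ and $\mathrm{bn}(\alpha)\#Q$ then $P\mid Q\xrightarrow\alpha P'\mid Q$ (and symmetrically). - Case: if $P_i\xrightarrow\alpha P'$ and $\mathbf 1\vdash\varphi_i$ then $\mathbf{case}\ \tilde\varphi:\tilde P\xrightarrow\alpha P'$. - Rep: if $P\mid{!P}\xrightarrow\alpha P'$ then $!P\xrightarrow\alpha P'$. - Scope: if $P\xrightarrow\alpha P'$ and $b\#\alpha$ then $(\nu b)P\xrightarrow\alpha(\nu b)P'$. - Open: if $P\xrightarrow{\overline M(\nu\tilde a)N}P'$, $b\#\tilde a,M$, $b\in\mathrm n(N)$, then $(\nu b)P\xrightarrow{\overline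 M(\nu\tilde a\cup\{b\})N}P'$, where $\tilde a\cup\{b\}$ is $\tilde a$ with $b$ inserted anywhere. **Strong bisimulation congruence.** Since $\mathbf A=\{\mathbf 1\}$, a strong bisimulation is a symmetric relation $\mathcal R$ on agents whose related agents have frames entailing the same conditions (automatic here) and such that if $P\,\mathcal R\,Q$, $\mathrm{bn}(\alpha)\#Q$ and $P\xrightarrow\alpha P'$ then $Q\xrightarrow\alpha Q'$ with $P'\,\mathcal R\,Q'$ for some $Q'$; $\dot\sim$ is the largest one. $P\sim Q$ iff $P\tilde\sigma\mathrel{\dot\sim}Q\tilde\sigma$ for all finite sequences $\tilde\sigma$ of (sort-preserving) substitutions. **Structural congruence of psi-agents.** $\equiv$ is the smallest equivalence relation on agents closed under all agent constructors satisfying, whenever $a\#Q,\tilde x,M,N,X,\tilde\varphi$: $\mathbf{case}\ \varphi_1:(\nu a)P_1[]\cdots[]\varphi_n:(\nu a)P_n\equiv(\nu a)\mathbf{case}\ \tilde\varphi:\tilde P$; $\underline M(\lambda\tilde x)X.(\nu a)P\equiv(\nu a)\underline M(\lambda\tilde x)X.P$; $\overline M\,N.(\nu a)P\equiv(\nu a)\overline M\,N.P$; $Q\mid(\nu a)P\equiv(\nu a)(Q\mid P)$; $(\nu b)(\nu a)P\equiv(\nu a)(\nu b)P$; $!P\equiv P\mid{!P}$; $P\mid(Q\mid R)\equiv(P\mid Q)\mid R$; $P\mid Q\equiv Q\mid P$; $P\equiv P\mid\mathbf 0$; $(\nu a)\mathbf 0\equiv\mathbf 0$. **Representation.** A context $C$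 of arity $k$ is a (raw) psi-calculus process term with $k$ occurrences of $\mathbf 0$ replaced by holes, and $C[P_1,\dots,P_k]$ fills the holes from left to right (possibly capturing names). A psi-calculus is a representation of a process calculus with processes $\mathcal P$ and labelled transition system $\to\;\subseteq\mathcal P\times\mathcal A\times\mathcal P$ if there exist an equivariant map $[\![\cdot]\!]$ from $\mathcal P$ to psi-calculus processes and an equivariant relation $\approxeq$ between $\mathcal A$ and psi-calculus actions such that: (1) for each process constructor $f$ of $\mathcal P$ there is an equivariant psi-calculus context $C$ (depending equivariantly on the name parameters of $f$, such as $x,\tilde y$ in $x(\tilde y).[\,]$) such that $[\![f(P_1,\dots,P_n)]\!]=C[[\![P_1]\!],\dots,[\![P_n]\!]]$; (2a) whenever $P\xrightarrow\beta P'$ there are $\alpha,Q$ with $[\![P]\!]\xrightarrow\alpha Q$, $[\![P']\!]\equiv Q$ and $\beta\approxeq\alpha$; (2b) whenever $[\![P]\!]\xrightarrow\alpha Q$ there are $\beta,P'$ with $P\xrightarrow\beta P'$, $[\![P']\!]\equiv Q$ and $\beta\approxeq\alpha$. It is complete if moreover (3) for each psi process $P$ there is $Q\in\mathcal P$ with $P\sim[\![Q]\!]$. **Sorted polyadic pi-calculus.** Its processes are the well-sorted processes among $P,Q::=\mathbf 0\mid x(\tilde y).P\mid\overline x\langle\tilde y\rangle.P\mid[a=b]P\mid\nu x\,P\mid{!P}\mid P\mid Q\mid P+Q$, where in $x(\tilde y).P$ the names $\tilde y$ are distinct and bind in $P$, $\nu x$ binds $x$, processes are up to alpha-equivalence,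 and $\mathrm{fn}$ denotes free names. A process is well-sorted if for every input prefix $a(b_1,\dots,b_n)$ and every output prefix $\overline a\langle b_1,\dots,b_n\rangle$ in it, $a$ has some sort $s$ such that $\mathtt{ob}(s)$ is the sequence of sorts of $b_1,\dots,b_n$. Actions: $(\nu\tilde y')\overline z\langle\tilde y\rangle$ with $\tilde y'\subseteq\tilde y$ distinct and $z\notin\tilde y'$ (the order of the bound names $\tilde y'$ is immaterial), $x\langle\tilde z\rangle$, $\tau$. Rules (symmetric ones included): $\overline x\langle\tilde y\rangle.P\xrightarrow{\overline x\langle\tilde y\rangle}P$; $x(\tilde y).P\xrightarrow{x\langle\tilde z\rangle}P\{\tilde z/\tilde y\}$ if $\tilde z,\tilde y$ have the same sequence of sorts; $P\xrightarrow\beta P'$ implies $P+Q\xrightarrow\beta P'$, $[x=x]P\xrightarrow\beta P'$, $P\mid Q\xrightarrow\beta P'\mid Q$ if $\mathrm{bn}(\beta)\cap\mathrm{fn}(Q)=\emptyset$, and $\nu x\,P\xrightarrow\beta\nu x\,P'$ if $x\notin\mathrm n(\beta)$; $P\mid{!P}\xrightarrow\beta P'$ implies $!P\xrightarrow\beta P'$; $P\xrightarrow{(\nu\tilde y')\overline x\langle\tilde y\rangle}P'$ and $Q\xrightarrow{x\langle\tilde y\rangle}Q'$ with $\tilde y'\cap\mathrm{fn}(Q)=\emptyset$ imply $P\mid Q\xrightarrow\tau\nu\tilde y'(P'\mid Q')$; $P\xrightarrow{(\nu\tilde y')\overline z\langle\tilde y\rangle}P'$ with $x\ne z$, $x\in\tilde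 y\setminus\tilde y'$ implies $\nu x\,P\xrightarrow{(\nu x,\tilde y')\overline z\langle\tilde y\rangle}P'$. -}

module Defs where

open import Data.Nat.Base using (ℕ; _+_)
import Data.Nat.Properties as ℕ
open import Data.Fin.Base using (Fin; zero; suc)
open import Data.Fin.Permutation using (Permutation′; _⟨$⟩ʳ_)
open import Data.Maybe.Base using (Maybe; just)
open import Data.List.Base as List using (List; []; _∷_; _++_)
open import Data.List.Properties as List using (map-∘; map-cong)
open import Data.List.Membership.Propositional using (_∈_; _∉_)
open import Data.List.Relation.Unary.All using (All; []; _∷_)
open import Data.List.Relation.Binary.Pointwise.Base using (Pointwise)
open import Data.List.Relation.Binary.Permutation.Propositional using (_↭_)
import Data.List.Relation.Unary.Unique.Propositional as ListUnique
open import Data.Vec.Base as Vec using (Vec; []; _∷_; toList; lookup; tabulate)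
import Data.Vec.Properties as Vec
open import Data.Vec.Relation.Unary.Unique.Propositional using (Unique)
import Data.Vec.Relation.Unary.Unique.Propositional.Properties as Unique
open import Data.Product.Base using (Σ; Σ-syntax; ∃-syntax; _×_; _,_; proj₁; proj₂; map₂)
import Data.Product.Properties as Product
open import Data.Sum.Base as Sum using (_⊎_; inj₁; inj₂; [_,_])
open import Data.Empty using (⊥)
open import Function.Base using (_∘_)
open import Function.Bundles using (_↣_; _↔_)
open import Function.Properties.Inverse using (↔⇒↣)
open import Relation.Nullary using (¬_; yes; no; contradiction)
open import Relation.Nullary.Decidable using (via-injection)
open import Relation.Binary.Definitions using (DecidableEquality; Symmetric)
open import Relation.Binary.PropositionalEquality
  using (_≡_; refl; sym; trans; cong; subst)

record Signature : Set₁ where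
  field
    Subject     : Set
    countable   : Subject ↣ ℕ
    𝒩           : Subject → Set
    𝒩-countable : ∀ s → 𝒩 s ↔ ℕ
    ob          : Subject → Maybe (List Subject)

module Calculi (Sig : Signature) where
  open Signature Sig

  -- The sets 𝒩 s are made pairwise disjoint by the tagging in Σ.
  Name : Set
  Name = Σ Subject 𝒩

  sort : Name → Subject
  sort = proj₁

  _≟_ : DecidableEquality Name
  _≟_ = Product.≡-dec (via-injection countable ℕ._≟_)
                      (λ {s} → via-injection (↔⇒↣ (𝒩-countable s)) ℕ._≟_)

  swapName : Name → Name → Name → Name
  swapName a b c with c ≟ a
  ... | yes _ = b
  ... | no  _ with c ≟ b
  ...   | yes _ = a
  ...   | no  _ = c

  record Swapping : Set where
    constructor swapping
    field
      a b  : Name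
      same : sort a ≡ sort b

  act : Swapping → Name → Name
  act (swapping a b _) = swapName a b

  act-sort : ∀ π c → sort (act π c) ≡ sort c
  act-sort (swapping a b same) c with c ≟ a
  ... | yes refl = sym same
  ... | no  _ with c ≟ b
  ...   | yes refl = same
  ...   | no  _    = refl

  act-involutive : ∀ π c → act π (act π c) ≡ c
  act-involutive (swapping a b same) c with c ≟ a
  act-involutive (swapping a b same) c | yes refl with b ≟ c
  ... | yes b≡c = b≡c
  ... | no  _ with b ≟ b
  ...   | yes _   = refl
  ...   | no  b≢b = contradiction refl b≢b
  act-involutive (swapping a b same) c | no c≢a with c ≟ b
  act-involutive (swapping a b same) c | no c≢a | yes refl with a ≟ a
  ... | yes _   = refl
  ... | no  a≢a = contradiction refl a≢a
  act-involutive (swapping a b same) c | no c≢a | no c≢b with c ≟ a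
  ... | yes c≡a = contradiction c≡a c≢a
  ... | no  _ with c ≟ b
  ...   | yes c≡b = contradiction c≡b c≢b
  ...   | no  _   = refl

  act-injective : ∀ π {c d} → act π c ≡ act π d → c ≡ d
  act-injective π {c} {d} e =
    trans (sym (act-involutive π c)) (trans (cong (act π) e) (act-involutive π d))

  -- Simultaneous substitution of names for names; ã is meant to be distinct.
  infix 4 _:=_

  _:=_ : ∀ {n} → Vec Name n → Vec Name n → Name → Name
  ([]    := [])    c = c
  (a ∷ ã := b ∷ b̃) c with c ≟ a
  ... | yes _ = b
  ... | no  _ = (ã := b̃) c

  :=-sort : ∀ {n} (ã b̃ : Vec Name n) → Vec.map sort ã ≡ Vec.map sort b̃ →
            ∀ c → sort ((ã := b̃) c) ≡ sort c
  :=-sort []      []      _ c = refl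
  :=-sort (a ∷ ã) (b ∷ b̃) e c with c ≟ a
  ... | yes refl = sym (Vec.∷-injectiveˡ e)
  ... | no  _    = :=-sort ã b̃ (Vec.∷-injectiveʳ e) c

  record Substitution : Set where
    field
      {size}   : ℕ
      dom cod  : Vec Name size
      distinct : Unique dom
      same     : Vec.map sort dom ≡ Vec.map sort cod

  -- Alpha-equivalence classes are represented namelessly: an object under a binder for
  -- names of sorts s₁,…,sₙ has its names drawn from Fin n ⊎ V, where inj₁ i is the i-th
  -- bound name and inj₂ v is a name v of the surrounding scope.  Objects over V = Name
  -- are therefore exactly the alpha-classes, and renaming free names never captures.
  -- abstr x̃ turns the names x̃ into bound ones; with it, the binding constructors of the
  -- informal syntax are defined as functions taking the bound names.
  ext : ∀ {n} {V : Set} → Vec Subject n → (V → Subject) → Fin n ⊎ V → Subject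
  ext Δ srt = [ lookup Δ , srt ]

  abstr : ∀ {n} → Vec Name n → Name → Fin n ⊎ Name
  abstr []      c = inj₂ c
  abstr (x ∷ x̃) c with c ≟ x
  ... | yes _ = inj₁ zero
  ... | no  _ = Sum.map₁ suc (abstr x̃ c)

  abstr-sort : ∀ {n} (x̃ : Vec Name n) c →
               ext (Vec.map sort x̃) sort (abstr x̃ c) ≡ sort c
  abstr-sort []      c = refl
  abstr-sort (x ∷ x̃) c with c ≟ x
  ... | yes refl = refl
  ... | no  _ with abstr x̃ c | abstr-sort x̃ c
  ...   | inj₁ i | e = e
  ...   | inj₂ d | e = e

  ext-map : ∀ {n} {V W : Set} (Δ : Vec Subject n)
            {srtV : V → Subject} {srtW : W → Subject} (f : V → W) →
            (∀ v → srtW (f v) ≡ srtV v) →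
            ∀ r → ext Δ srtW (Sum.map₂ f r) ≡ ext Δ srtV r
  ext-map Δ f h (inj₁ i) = refl
  ext-map Δ f h (inj₂ v) = h v

  module SortedPPi where

    data Sort : Set where
      subj : Subject → Sort
      ⟨_⟩ₛ : List Subject → Sort

    data Term (V : Set) : Set where
      name : V → Term V
      ⟨_⟩  : List V → Term V

    SORT : {V : Set} → (V → Subject) → Term V → Sort
    SORT srt (name a) = subj (srt a)
    SORT srt ⟨ ã ⟩    = ⟨ List.map srt ã ⟩ₛ

    names : {V : Set} → Term V → List V
    names (name a) = a ∷ []
    names ⟨ ã ⟩    = ã

    mapTerm : {V W : Set} → (V → W) → Term V → Term W
    mapTerm f (name a) = name (f a)
    mapTerm f ⟨ ã ⟩    = ⟨ List.map f ã ⟩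

    data Cond (V : Set) : Set where
      ⊤ᶜ ⊥ᶜ : Cond V
      _≐_   : V → V → Cond V

    condNames : {V : Set} → Cond V → List V
    condNames ⊤ᶜ      = []
    condNames ⊥ᶜ      = []
    condNames (a ≐ b) = a ∷ b ∷ []

    mapCond : {V W : Set} → (V → W) → Cond V → Cond W
    mapCond f ⊤ᶜ      = ⊤ᶜ
    mapCond f ⊥ᶜ      = ⊥ᶜ
    mapCond f (a ≐ b) = f a ≐ f b

    data Assertion : Set where
      𝟏 : Assertion

    infix 4 _⊢_

    data _⊢_ : Assertion → Cond Name → Set where
      ⊢⊤ : 𝟏 ⊢ ⊤ᶜ
      ⊢≐ : ∀ {a} → 𝟏 ⊢ (a ≐ a)

    infix 5 _↔ᶜ_

    _↔ᶜ_ : {V : Set} → Term V → Term V → Cond V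
    name a ↔ᶜ name b = a ≐ b
    _      ↔ᶜ _      = ⊥ᶜ

    -- A pattern ⟨ỹ⟩ is given by the list of its entries; distinctness is part of WF.
    Pattern : Set → Set
    Pattern V = List V

    infixl 6 _·_

    _·_ : ∀ {n} {A : Set} → Permutation′ n → Vec A n → Vec A n
    π · ã = tabulate (λ i → lookup ã (π ⟨$⟩ʳ i))

    -- L̃ ∈ MATCH(N, x̃, X)
    Match : ∀ {n} → Term Name → Vec Name n → Pattern Name → Vec Name n → Set
    Match {n} N x̃ X L̃ =
      Σ[ ã ∈ Vec Name n ] Σ[ ỹ ∈ Vec Name n ] Σ[ π ∈ Permutation′ n ]
        N ≡ ⟨ toList ã ⟩ × X ≡ toList ỹ × Vec.map sort ã ≡ Vec.map sort ỹ ×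
        x̃ ≡ π · ỹ × L̃ ≡ π · ã

    infixr 6 _∣_

    data Agent (V : Set) : Set where
      output : Term V → Term V → Agent V → Agent V
      input′ : ∀ {n} → Term V → (Δ : Vec Subject n) →
               Pattern (Fin n ⊎ V) → Agent (Fin n ⊎ V) → Agent V
      case   : List (Cond V × Agent V) → Agent V
      ν′     : Subject → Agent (Fin 1 ⊎ V) → Agent V
      _∣_    : Agent V → Agent V → Agent V
      !_     : Agent V → Agent V
      ⦅_⦆    : Assertion → Agent V

    𝟎 : {V : Set} → Agent V
    𝟎 = case []

    mapAgent    : {V W : Set} → (V → W) → Agent V → Agent W
    mapBranches : {V W : Set} → (V → W) →
                  List (Cond V × Agent V) → List (Cond W × Agent W)
    mapAgent f (output M N P)   = output (mapTerm f M) (mapTerm f N) (mapAgent f P)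
    mapAgent f (input′ M Δ X P) =
      input′ (mapTerm f M) Δ (List.map (Sum.map₂ f) X) (mapAgent (Sum.map₂ f) P)
    mapAgent f (case bs) = case (mapBranches f bs)
    mapAgent f (ν′ s P)  = ν′ s (mapAgent (Sum.map₂ f) P)
    mapAgent f (P ∣ Q)   = mapAgent f P ∣ mapAgent f Q
    mapAgent f (! P)     = ! mapAgent f P
    mapAgent f ⦅ Ψ ⦆     = ⦅ Ψ ⦆
    mapBranches f []             = []
    mapBranches f ((φ , P) ∷ bs) = (mapCond f φ , mapAgent f P) ∷ mapBranches f bs

    -- input M x̃ X P is M(λx̃)X.P
    input : ∀ {n} → Term Name → Vec Name n → Pattern Name → Agent Name → Agent Name
    input M x̃ X P =
      input′ M (Vec.map sort x̃) (List.map (abstr x̃) X) (mapAgent (abstr x̃) P)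

    ν : Name → Agent Name → Agent Name
    ν a P = ν′ (sort a) (mapAgent (abstr (a ∷ [])) P)

    ν* : List Name → Agent Name → Agent Name
    ν* ã P = List.foldr ν P ã

    infix 4 _∈fn_ _∈fnᵇ_ _#_

    _∈fn_  : {V : Set} → V → Agent V → Set
    _∈fnᵇ_ : {V : Set} → V → List (Cond V × Agent V) → Set
    v ∈fn output M N P   = v ∈ names M ⊎ v ∈ names N ⊎ v ∈fn P
    v ∈fn input′ M Δ X P = v ∈ names M ⊎ inj₂ v ∈ X ⊎ inj₂ v ∈fn P
    v ∈fn case bs        = v ∈fnᵇ bs
    v ∈fn ν′ s P         = inj₂ v ∈fn P
    v ∈fn (P ∣ Q)        = v ∈fn P ⊎ v ∈fn Q
    v ∈fn (! P)          = v ∈fn P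
    v ∈fn ⦅ Ψ ⦆          = ⊥
    v ∈fnᵇ []             = ⊥
    v ∈fnᵇ ((φ , P) ∷ bs) = v ∈ condNames φ ⊎ v ∈fn P ⊎ v ∈fnᵇ bs

    _#_ : Name → Agent Name → Set
    a # P = ¬ (a ∈fn P)

    data Guarded {V : Set} : Agent V → Set where
      g-output : ∀ {M N P} → Guarded (output M N P)
      g-input  : ∀ {n M} {Δ : Vec Subject n} {X P} → Guarded (input′ M Δ X P)
      g-case   : ∀ {bs} → All (Guarded ∘ proj₂) bs → Guarded (case bs)
      g-ν      : ∀ {s P} → Guarded P → Guarded (ν′ s P)
      g-par    : ∀ {P Q} → Guarded P → Guarded Q → Guarded (P ∣ Q)
      g-rep    : ∀ {P} → Guarded P → Guarded (! P)

    -- M can send terms of, and receive with patterns of, the given sort.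
    data Carries {V : Set} (srt : V → Subject) : Term V → Sort → Set where
      carries : ∀ {a t̃} → ob (srt a) ≡ just t̃ → Carries srt (name a) ⟨ t̃ ⟩ₛ

    -- In the input case the binder positions are automatically distinct names x̃, and
    -- `positions` says that the distinct entries of the pattern are exactly those names.
    data WF {V : Set} (srt : V → Subject) : Agent V → Set where
      wf-output : ∀ {M N P} → Carries srt M (SORT srt N) → WF srt P → WF srt (output M N P)
      wf-input  : ∀ {n M} {Δ : Vec Subject n} {X P} →
                  Carries srt M (SORT (ext Δ srt) ⟨ X ⟩) →
                  (positions : Σ[ is ∈ List (Fin n) ]
                    X ≡ List.map inj₁ is × ListUnique.Unique is × (∀ i → i ∈ is)) →
                  WF (ext Δ srt) P →
                  WF srt (input′ M Δ X P)
      wf-case   : ∀ {bs} → All (λ b → WF srt (proj₂ b) × Guarded (proj₂ b)) bs →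
                  WF srt (case bs)
      wf-ν      : ∀ {s P} → WF (ext (s ∷ []) srt) P → WF srt (ν′ s P)
      wf-par    : ∀ {P Q} → WF srt P → WF srt Q → WF srt (P ∣ Q)
      wf-rep    : ∀ {P} → WF srt P → Guarded P → WF srt (! P)
      wf-assert : ∀ {Ψ} → WF srt ⦅ Ψ ⦆

    record Process : Set where
      constructor process
      field
        agent : Agent Name
        wf    : WF sort agent

    open Process public

    mapAgent-Guarded : {V W : Set} (f : V → W) {P : Agent V} →
                       Guarded P → Guarded (mapAgent f P)
    mapBranches-Guarded : {V W : Set} (f : V → W) {bs : List (Cond V × Agent V)} →
                          All (Guarded ∘ proj₂) bs → All (Guarded ∘ proj₂) (mapBranches f bs)
    mapAgent-Guarded f g-output    = g-output
    mapAgent-Guarded f g-input     = g-input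
    mapAgent-Guarded f (g-case gs) = g-case (mapBranches-Guarded f gs)
    mapAgent-Guarded f (g-ν g)     = g-ν (mapAgent-Guarded _ g)
    mapAgent-Guarded f (g-par g h) = g-par (mapAgent-Guarded f g) (mapAgent-Guarded f h)
    mapAgent-Guarded f (g-rep g)   = g-rep (mapAgent-Guarded f g)
    mapBranches-Guarded f []       = []
    mapBranches-Guarded f (g ∷ gs) = mapAgent-Guarded f g ∷ mapBranches-Guarded f gs

    module _ {V W : Set} {srtV : V → Subject} {srtW : W → Subject} (f : V → W)
             (f-sort : ∀ v → srtW (f v) ≡ srtV v) where

      mapTerm-SORT : ∀ N → SORT srtW (mapTerm f N) ≡ SORT srtV N
      mapTerm-SORT (name a) = cong subj (f-sort a)
      mapTerm-SORT ⟨ ã ⟩    = cong ⟨_⟩ₛ (trans (sym (map-∘ ã)) (map-cong f-sort ã))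

      mapTerm-Carries : ∀ {M t} → Carries srtV M t → Carries srtW (mapTerm f M) t
      mapTerm-Carries (carries {a} e) = carries (trans (cong ob (f-sort a)) e)

    mapAgent-WF : {V W : Set} {srtV : V → Subject} {srtW : W → Subject} (f : V → W) →
                  (∀ v → srtW (f v) ≡ srtV v) →
                  ∀ {P} → WF srtV P → WF srtW (mapAgent f P)
    mapBranches-WF : {V W : Set} {srtV : V → Subject} {srtW : W → Subject} (f : V → W) →
                     (∀ v → srtW (f v) ≡ srtV v) →
                     ∀ {bs} → All (λ b → WF srtV (proj₂ b) × Guarded (proj₂ b)) bs →
                     All (λ b → WF srtW (proj₂ b) × Guarded (proj₂ b)) (mapBranches f bs)
    mapAgent-WF {srtW = srtW} f h (wf-output {M} {N} c w) =
      wf-output (subst (Carries srtW (mapTerm f M)) (sym (mapTerm-SORT f h N))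
                    (mapTerm-Carries f h c))
             (mapAgent-WF f h w)
    mapAgent-WF {srtW = srtW} f h (wf-input {M = M} {Δ} {X} c (is , e , u , all) w) =
      wf-input (subst (Carries srtW (mapTerm f M))
                   (sym (mapTerm-SORT (Sum.map₂ f) (ext-map Δ f h) ⟨ X ⟩))
                   (mapTerm-Carries f h c))
            (is , trans (cong (List.map (Sum.map₂ f)) e) (sym (map-∘ is)) , u , all)
            (mapAgent-WF (Sum.map₂ f) (ext-map Δ f h) w)
    mapAgent-WF f h (wf-case ws)  = wf-case (mapBranches-WF f h ws)
    mapAgent-WF f h (wf-ν w)      = wf-ν (mapAgent-WF (Sum.map₂ f) (ext-map (_ ∷ []) f h) w)
    mapAgent-WF f h (wf-par v w)  = wf-par (mapAgent-WF f h v) (mapAgent-WF f h w)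
    mapAgent-WF f h (wf-rep w g)  = wf-rep (mapAgent-WF f h w) (mapAgent-Guarded f g)
    mapAgent-WF f h wf-assert     = wf-assert
    mapBranches-WF f h []             = []
    mapBranches-WF f h ((w , g) ∷ ws) =
      (mapAgent-WF f h w , mapAgent-Guarded f g) ∷ mapBranches-WF f h ws

    infixl 7 _⟦_⟧ _⟦_⟧*

    _⟦_⟧ : Process → Substitution → Process
    process P w ⟦ σ ⟧ = process (mapAgent (dom := cod) P) (mapAgent-WF _ (:=-sort dom cod same) w)
      where open Substitution σ

    _⟦_⟧* : Process → List Substitution → Process
    P ⟦ σ̃ ⟧* = List.foldl _⟦_⟧ P σ̃

    -- out M ã N is the action M̄(νã)N.  That ã consists of distinct names of N, none of
    -- them in M, is an invariant of the transition rules.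
    data Act : Set where
      out : Term Name → List Name → Term Name → Act
      inp : Term Name → Term Name → Act
      τ   : Act

    bn : Act → List Name
    bn (out M ã N) = ã
    bn (inp M N)   = []
    bn τ           = []

    actNames : Act → List Name
    actNames (out M ã N) = names M ++ ã ++ names N
    actNames (inp M N)   = names M ++ names N
    actNames τ           = []

    mapAct : (Name → Name) → Act → Act
    mapAct f (out M ã N) = out (mapTerm f M) (List.map f ã) (mapTerm f N)
    mapAct f (inp M N)   = inp (mapTerm f M) (mapTerm f N)
    mapAct f τ           = τ

    infix 4 _-[_]→_

    -- Since `input` and `ν` produce alpha-classes, the bound names mentioned in a source
    -- can be chosen at will.  ALPHA makes the bound names of an output action bind into
    -- object and derivative; they are always kept apart from the subject.
    data _-[_]→_ : Agent Name → Act → Agent Name → Set where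
      IN : ∀ {n M K N X P} {ỹ L̃ : Vec Name n} → Unique ỹ →
           𝟏 ⊢ M ↔ᶜ K → Match N ỹ X L̃ →
           input M ỹ X P -[ inp K N ]→ mapAgent (ỹ := L̃) P
      OUT : ∀ {M K N P} → 𝟏 ⊢ M ↔ᶜ K →
            output M N P -[ out K [] N ]→ P
      COMˡ : ∀ {P Q P′ Q′ M K ã N} →
             P -[ out M ã N ]→ P′ → Q -[ inp K N ]→ Q′ → 𝟏 ⊢ M ↔ᶜ K → All (_# Q) ã →
             P ∣ Q -[ τ ]→ ν* ã (P′ ∣ Q′)
      COMʳ : ∀ {P Q P′ Q′ M K ã N} →
             P -[ inp K N ]→ P′ → Q -[ out M ã N ]→ Q′ → 𝟏 ⊢ M ↔ᶜ K → All (_# P) ã →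
             P ∣ Q -[ τ ]→ ν* ã (P′ ∣ Q′)
      PARˡ : ∀ {P Q P′ α} → P -[ α ]→ P′ → All (_# Q) (bn α) → P ∣ Q -[ α ]→ P′ ∣ Q
      PARʳ : ∀ {P Q Q′ α} → Q -[ α ]→ Q′ → All (_# P) (bn α) → P ∣ Q -[ α ]→ P ∣ Q′
      CASE : ∀ {bs φ P P′ α} → (φ , P) ∈ bs → P -[ α ]→ P′ → 𝟏 ⊢ φ → case bs -[ α ]→ P′
      REP : ∀ {P P′ α} → P ∣ ! P -[ α ]→ P′ → ! P -[ α ]→ P′
      SCOPE : ∀ {b P P′ α} → P -[ α ]→ P′ → b ∉ actNames α → ν b P -[ α ]→ ν b P′
      OPEN : ∀ {b P P′ M N} (ã₁ ã₂ : List Name) → P -[ out M (ã₁ ++ ã₂) N ]→ P′ →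
             b ∉ ã₁ ++ ã₂ → b ∉ names M → b ∈ names N →
             ν b P -[ out M (ã₁ ++ b ∷ ã₂) N ]→ P′
      ALPHA : ∀ {P P′ M ã N a b} → P -[ out M ã N ]→ P′ →
              a ∈ ã → sort a ≡ sort b → b ∉ names M → b ∉ names N → b # P′ →
              P -[ out M (List.map (swapName a b) ã) (mapTerm (swapName a b) N) ]→
              mapAgent (swapName a b) P′

    -- All frames entail the same conditions here, so there is no clause for them.
    record Bisimulation (R : Process → Process → Set) : Set where
      field
        symmetric : Symmetric R
        simulates : ∀ {P Q α P′} → R P Q → All (_# agent Q) (bn α) →
                    agent P -[ α ]→ agent P′ →
                    ∃[ Q′ ] agent Q -[ α ]→ agent Q′ × R P′ Q′

    infix 4 _∼̇_ _∼_ _≡ₛ_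

    _∼̇_ : Process → Process → Set₁
    P ∼̇ Q = ∃[ R ] Bisimulation R × R P Q

    _∼_ : Process → Process → Set₁
    P ∼ Q = (σ̃ : List Substitution) → P ⟦ σ̃ ⟧* ∼̇ Q ⟦ σ̃ ⟧*

    -- Each law preserves well-formedness in both directions.
    data _≡ₛ_ : Agent Name → Agent Name → Set where
      ≡-refl  : ∀ {P} → P ≡ₛ P
      ≡-sym   : ∀ {P Q} → P ≡ₛ Q → Q ≡ₛ P
      ≡-trans : ∀ {P Q R} → P ≡ₛ Q → Q ≡ₛ R → P ≡ₛ R

      output-cong : ∀ {M N P Q} → P ≡ₛ Q → output M N P ≡ₛ output M N Q
      input-cong  : ∀ {n M X P Q} {x̃ : Vec Name n} → Unique x̃ →
                    P ≡ₛ Q → input M x̃ X P ≡ₛ input M x̃ X Q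
      case-cong   : ∀ {bs cs} →
                    Pointwise (λ b c → proj₁ b ≡ proj₁ c × proj₂ b ≡ₛ proj₂ c) bs cs →
                    case bs ≡ₛ case cs
      ν-cong      : ∀ {a P Q} → P ≡ₛ Q → ν a P ≡ₛ ν a Q
      par-cong    : ∀ {P P′ Q Q′} → P ≡ₛ P′ → Q ≡ₛ Q′ → P ∣ Q ≡ₛ P′ ∣ Q′
      rep-cong    : ∀ {P Q} → P ≡ₛ Q → ! P ≡ₛ ! Q

      case-ν   : ∀ {a bs} → All (λ b → a ∉ condNames (proj₁ b)) bs →
                 case (List.map (map₂ (ν a)) bs) ≡ₛ ν a (case bs)
      input-ν  : ∀ {n M X P a} {x̃ : Vec Name n} → Unique x̃ →
                 a ∉ names M → a ∉ toList x̃ → a ∉ X →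
                 input M x̃ X (ν a P) ≡ₛ ν a (input M x̃ X P)
      output-ν : ∀ {M N P a} → a ∉ names M → a ∉ names N →
                 output M N (ν a P) ≡ₛ ν a (output M N P)
      par-ν    : ∀ {P Q a} → a # Q → Q ∣ ν a P ≡ₛ ν a (Q ∣ P)
      ν-ν      : ∀ {P a b} → ν b (ν a P) ≡ₛ ν a (ν b P)
      unfold   : ∀ {P} → ! P ≡ₛ P ∣ ! P
      assoc    : ∀ {P Q R} → P ∣ (Q ∣ R) ≡ₛ (P ∣ Q) ∣ R
      comm     : ∀ {P Q} → P ∣ Q ≡ₛ Q ∣ P
      unit     : ∀ {P} → P ≡ₛ P ∣ 𝟎
      ν-𝟎      : ∀ {a} → ν a 𝟎 ≡ₛ 𝟎

    -- Contexts are raw terms with named binders, not identified up to alpha-equivalence;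
    -- the index counts the holes.
    data Ctx         : ℕ → Set
    data CtxBranches : ℕ → Set

    data Ctx where
      hole   : Ctx 1
      output : ∀ {k} → Term Name → Term Name → Ctx k → Ctx k
      inputᶜ : ∀ {k n} → Term Name → Vec Name n → Pattern Name → Ctx k → Ctx k
      case   : ∀ {k} → CtxBranches k → Ctx k
      νᶜ     : ∀ {k} → Name → Ctx k → Ctx k
      _∣_    : ∀ {k l} → Ctx k → Ctx l → Ctx (k + l)
      !_     : ∀ {k} → Ctx k → Ctx k
      ⦅_⦆    : Assertion → Ctx 0

    data CtxBranches where
      []    : CtxBranches 0
      _∶_∷_ : ∀ {k l} → Cond Name → Ctx k → CtxBranches l → CtxBranches (k + l)

    plug         : ∀ {k} → Ctx k → Vec (Agent Name) k → Agent Name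
    plugBranches : ∀ {k} → CtxBranches k → Vec (Agent Name) k → List (Cond Name × Agent Name)
    plug hole             (P ∷ []) = P
    plug (output M N C)   P̃ = output M N (plug C P̃)
    plug (inputᶜ M x̃ X C) P̃ = input M x̃ X (plug C P̃)
    plug (case B)         P̃ = case (plugBranches B P̃)
    plug (νᶜ a C)         P̃ = ν a (plug C P̃)
    plug (_∣_ {k} C D)    P̃ = plug C (Vec.take k P̃) ∣ plug D (Vec.drop k P̃)
    plug (! C)            P̃ = ! plug C P̃
    plug ⦅ Ψ ⦆            P̃ = ⦅ Ψ ⦆
    plugBranches []                P̃ = []
    plugBranches (_∶_∷_ {k} φ C B) P̃ =
      (φ , plug C (Vec.take k P̃)) ∷ plugBranches B (Vec.drop k P̃)

    mapCtx         : ∀ {k} → (Name → Name) → Ctx k → Ctx k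
    mapCtxBranches : ∀ {k} → (Name → Name) → CtxBranches k → CtxBranches k
    mapCtx f hole            = hole
    mapCtx f (output M N C)  = output (mapTerm f M) (mapTerm f N) (mapCtx f C)
    mapCtx f (inputᶜ M x̃ X C) =
      inputᶜ (mapTerm f M) (Vec.map f x̃) (List.map f X) (mapCtx f C)
    mapCtx f (case B) = case (mapCtxBranches f B)
    mapCtx f (νᶜ a C) = νᶜ (f a) (mapCtx f C)
    mapCtx f (C ∣ D)  = mapCtx f C ∣ mapCtx f D
    mapCtx f (! C)    = ! mapCtx f C
    mapCtx f ⦅ Ψ ⦆    = ⦅ Ψ ⦆
    mapCtxBranches f []          = []
    mapCtxBranches f (φ ∶ C ∷ B) = mapCond f φ ∶ mapCtx f C ∷ mapCtxBranches f B

  module Ψ = SortedPPi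

  -- Op k contains the k-ary process constructors together with their name parameters.
  record ProcessCalculus : Set₁ where
    infix 4 _≈ₚ_ _≈ₐ_ _-[_]→_
    field
      Proc     : Set
      _≈ₚ_     : Proc → Proc → Set
      swapProc : Swapping → Proc → Proc
      Act      : Set
      _≈ₐ_     : Act → Act → Set
      swapAct  : Swapping → Act → Act
      _-[_]→_  : Proc → Act → Proc → Set
      Op       : ℕ → Set
      swapOp   : ∀ {k} → Swapping → Op k → Op k
      build    : ∀ {k} → Op k → Vec Proc k → Proc

  record Representation (𝒫 : ProcessCalculus) : Set₁ where
    open ProcessCalculus 𝒫
    field
      ⟦_⟧           : Proc → Ψ.Process
      ⟦⟧-cong       : ∀ {P Q} → P ≈ₚ Q → Ψ.agent ⟦ P ⟧ ≡ Ψ.agent ⟦ Q ⟧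
      ⟦⟧-equivariant : ∀ π P →
        Ψ.agent ⟦ swapProc π P ⟧ ≡ Ψ.mapAgent (act π) (Ψ.agent ⟦ P ⟧)

      _≊_           : Act → Ψ.Act → Set
      ≊-resp        : ∀ {β β′ α} → β ≈ₐ β′ → β ≊ α → β′ ≊ α
      ≊-equivariant : ∀ π {β α} → β ≊ α → swapAct π β ≊ Ψ.mapAct (act π) α

      ctx             : ∀ {k} → Op k → Ψ.Ctx k
      ctx-equivariant : ∀ {k} π (f : Op k) → ctx (swapOp π f) ≡ Ψ.mapCtx (act π) (ctx f)
      compositional   : ∀ {k} (f : Op k) (P̃ : Vec Proc k) →
        Ψ.agent ⟦ build f P̃ ⟧ ≡ Ψ.plug (ctx f) (Vec.map (Ψ.agent ∘ ⟦_⟧) P̃)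

      forth : ∀ {P β P′} → P -[ β ]→ P′ →
        Σ[ α ∈ Ψ.Act ] Σ[ Q ∈ Ψ.Process ]
          Ψ.agent ⟦ P ⟧ Ψ.-[ α ]→ Ψ.agent Q × Ψ.agent ⟦ P′ ⟧ Ψ.≡ₛ Ψ.agent Q × β ≊ α
      back  : ∀ {P α} {Q : Ψ.Process} → Ψ.agent ⟦ P ⟧ Ψ.-[ α ]→ Ψ.agent Q →
        Σ[ β ∈ Act ] Σ[ P′ ∈ Proc ]
          P -[ β ]→ P′ × Ψ.agent ⟦ P′ ⟧ Ψ.≡ₛ Ψ.agent Q × β ≊ α

  record CompleteRepresentation (𝒫 : ProcessCalculus) : Set₁ where
    field
      representation : Representation 𝒫
    open Representation representation public
    field
      complete : ∀ (P : Ψ.Process) → Σ[ Q ∈ ProcessCalculus.Proc 𝒫 ] P Ψ.∼ ⟦ Q ⟧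

  module SortedPi where

    infixr 6 _∣_ _⊕_

    data Pi (V : Set) : Set where
      𝟎      : Pi V
      input′ : ∀ {n} → V → Vec Subject n → Pi (Fin n ⊎ V) → Pi V
      output : V → List V → Pi V → Pi V
      match  : V → V → Pi V → Pi V
      ν′     : Subject → Pi (Fin 1 ⊎ V) → Pi V
      !_     : Pi V → Pi V
      _∣_    : Pi V → Pi V → Pi V
      _⊕_    : Pi V → Pi V → Pi V

    mapPi : {V W : Set} → (V → W) → Pi V → Pi W
    mapPi f 𝟎              = 𝟎
    mapPi f (input′ x Δ P) = input′ (f x) Δ (mapPi (Sum.map₂ f) P)
    mapPi f (output x ỹ P) = output (f x) (List.map f ỹ) (mapPi f P)
    mapPi f (match a b P)  = match (f a) (f b) (mapPi f P)
    mapPi f (ν′ s P)       = ν′ s (mapPi (Sum.map₂ f) P)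
    mapPi f (! P)          = ! mapPi f P
    mapPi f (P ∣ Q)        = mapPi f P ∣ mapPi f Q
    mapPi f (P ⊕ Q)        = mapPi f P ⊕ mapPi f Q

    input : ∀ {n} → Name → Vec Name n → Pi Name → Pi Name
    input x ỹ P = input′ x (Vec.map sort ỹ) (mapPi (abstr ỹ) P)

    ν : Name → Pi Name → Pi Name
    ν x P = ν′ (sort x) (mapPi (abstr (x ∷ [])) P)

    ν* : List Name → Pi Name → Pi Name
    ν* x̃ P = List.foldr ν P x̃

    infix 4 _∈fn_ _#_

    _∈fn_ : {V : Set} → V → Pi V → Set
    v ∈fn 𝟎            = ⊥
    v ∈fn input′ x Δ P = v ≡ x ⊎ inj₂ v ∈fn P
    v ∈fn output x ỹ P = v ≡ x ⊎ v ∈ ỹ ⊎ v ∈fn P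
    v ∈fn match a b P  = v ≡ a ⊎ v ≡ b ⊎ v ∈fn P
    v ∈fn ν′ s P       = inj₂ v ∈fn P
    v ∈fn (! P)        = v ∈fn P
    v ∈fn (P ∣ Q)      = v ∈fn P ⊎ v ∈fn Q
    v ∈fn (P ⊕ Q)      = v ∈fn P ⊎ v ∈fn Q

    _#_ : Name → Pi Name → Set
    a # P = ¬ (a ∈fn P)

    data WellSorted {V : Set} (srt : V → Subject) : Pi V → Set where
      ws-𝟎      : WellSorted srt 𝟎
      ws-input  : ∀ {n x} {Δ : Vec Subject n} {P} → ob (srt x) ≡ just (toList Δ) →
                  WellSorted (ext Δ srt) P → WellSorted srt (input′ x Δ P)
      ws-output : ∀ {x ỹ P} → ob (srt x) ≡ just (List.map srt ỹ) →
                  WellSorted srt P → WellSorted srt (output x ỹ P)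
      ws-match  : ∀ {a b P} → WellSorted srt P → WellSorted srt (match a b P)
      ws-ν      : ∀ {s P} → WellSorted (ext (s ∷ []) srt) P → WellSorted srt (ν′ s P)
      ws-rep    : ∀ {P} → WellSorted srt P → WellSorted srt (! P)
      ws-par    : ∀ {P Q} → WellSorted srt P → WellSorted srt Q → WellSorted srt (P ∣ Q)
      ws-sum    : ∀ {P Q} → WellSorted srt P → WellSorted srt Q → WellSorted srt (P ⊕ Q)

    record Process : Set where
      constructor process
      field
        term       : Pi Name
        wellSorted : WellSorted sort term

    open Process public

    map-ob : {V W : Set} {srtV : V → Subject} {srtW : W → Subject} (f : V → W) →
             (∀ v → srtW (f v) ≡ srtV v) →
             ∀ x ỹ → ob (srtV x) ≡ just (List.map srtV ỹ) →
             ob (srtW (f x)) ≡ just (List.map srtW (List.map f ỹ))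
    map-ob f h x ỹ e = trans (cong ob (h x))
      (trans e (cong just (trans (sym (map-cong h ỹ)) (map-∘ ỹ))))

    mapPi-WellSorted : {V W : Set} {srtV : V → Subject} {srtW : W → Subject} (f : V → W) →
                       (∀ v → srtW (f v) ≡ srtV v) →
                       ∀ {P} → WellSorted srtV P → WellSorted srtW (mapPi f P)
    mapPi-WellSorted f h ws-𝟎            = ws-𝟎
    mapPi-WellSorted f h (ws-input {x = x} {Δ} e w) =
      ws-input (trans (cong ob (h x)) e) (mapPi-WellSorted (Sum.map₂ f) (ext-map Δ f h) w)
    mapPi-WellSorted f h (ws-output {x} {ỹ} e w) =
      ws-output (map-ob f h x ỹ e) (mapPi-WellSorted f h w)
    mapPi-WellSorted f h (ws-match w) = ws-match (mapPi-WellSorted f h w)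
    mapPi-WellSorted f h (ws-ν w)     =
      ws-ν (mapPi-WellSorted (Sum.map₂ f) (ext-map (_ ∷ []) f h) w)
    mapPi-WellSorted f h (ws-rep w)   = ws-rep (mapPi-WellSorted f h w)
    mapPi-WellSorted f h (ws-par v w) = ws-par (mapPi-WellSorted f h v) (mapPi-WellSorted f h w)
    mapPi-WellSorted f h (ws-sum v w) = ws-sum (mapPi-WellSorted f h v) (mapPi-WellSorted f h w)

    swapProcess : Swapping → Process → Process
    swapProcess π (process P w) =
      process (mapPi (act π) P) (mapPi-WellSorted (act π) (act-sort π) w)

    -- out x̃ z ỹ is the action (νx̃) z̄⟨ỹ⟩.  That x̃ is a list of distinct elements of ỹ
    -- other than z is an invariant of the transition rules.
    data Act : Set where
      out : List Name → Name → List Name → Act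
      inp : Name → List Name → Act
      τ   : Act

    infix 4 _≈ₐ_

    data _≈ₐ_ : Act → Act → Set where
      out : ∀ {x̃ x̃′ z ỹ} → x̃ ↭ x̃′ → out x̃ z ỹ ≈ₐ out x̃′ z ỹ
      inp : ∀ {x z̃} → inp x z̃ ≈ₐ inp x z̃
      τ   : τ ≈ₐ τ

    bn : Act → List Name
    bn (out x̃ z ỹ) = x̃
    bn (inp x z̃)   = []
    bn τ           = []

    actNames : Act → List Name
    actNames (out x̃ z ỹ) = x̃ ++ z ∷ ỹ
    actNames (inp x z̃)   = x ∷ z̃
    actNames τ           = []

    swapAct : Swapping → Act → Act
    swapAct π (out x̃ z ỹ) = out (List.map (act π) x̃) (act π z) (List.map (act π) ỹ)
    swapAct π (inp x z̃)   = inp (act π x) (List.map (act π) z̃)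
    swapAct π τ           = τ

    infix 4 _-[_]→_

    -- PERM makes the order of the bound names of an action immaterial.  ALPHA makes them
    -- bind into the derivative; without it the bound names in the transitions of νx P
    -- could not be free in P, a restriction not shared by the psi-calculus transitions.
    data _-[_]→_ : Pi Name → Act → Pi Name → Set where
      OUT : ∀ {x ỹ P} → output x ỹ P -[ out [] x ỹ ]→ P
      IN : ∀ {n x P} {ỹ z̃ : Vec Name n} → Unique ỹ → Vec.map sort z̃ ≡ Vec.map sort ỹ →
           input x ỹ P -[ inp x (toList z̃) ]→ mapPi (ỹ := z̃) P
      SUMˡ : ∀ {P Q P′ β} → P -[ β ]→ P′ → P ⊕ Q -[ β ]→ P′
      SUMʳ : ∀ {P Q Q′ β} → Q -[ β ]→ Q′ → P ⊕ Q -[ β ]→ Q′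
      MATCH : ∀ {x P P′ β} → P -[ β ]→ P′ → match x x P -[ β ]→ P′
      PARˡ : ∀ {P Q P′ β} → P -[ β ]→ P′ → All (_# Q) (bn β) → P ∣ Q -[ β ]→ P′ ∣ Q
      PARʳ : ∀ {P Q Q′ β} → Q -[ β ]→ Q′ → All (_# P) (bn β) → P ∣ Q -[ β ]→ P ∣ Q′
      RES : ∀ {x P P′ β} → P -[ β ]→ P′ → x ∉ actNames β → ν x P -[ β ]→ ν x P′
      REP : ∀ {P P′ β} → P ∣ ! P -[ β ]→ P′ → ! P -[ β ]→ P′
      COMˡ : ∀ {P Q P′ Q′ x̃ z ỹ} →
             P -[ out x̃ z ỹ ]→ P′ → Q -[ inp z ỹ ]→ Q′ → All (_# Q) x̃ →
             P ∣ Q -[ τ ]→ ν* x̃ (P′ ∣ Q′)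
      COMʳ : ∀ {P Q P′ Q′ x̃ z ỹ} →
             P -[ inp z ỹ ]→ P′ → Q -[ out x̃ z ỹ ]→ Q′ → All (_# P) x̃ →
             P ∣ Q -[ τ ]→ ν* x̃ (P′ ∣ Q′)
      OPEN : ∀ {x P P′ x̃ z ỹ} → P -[ out x̃ z ỹ ]→ P′ → ¬ x ≡ z → x ∈ ỹ → x ∉ x̃ →
             ν x P -[ out (x ∷ x̃) z ỹ ]→ P′
      PERM : ∀ {P P′ x̃ x̃′ z ỹ} → P -[ out x̃ z ỹ ]→ P′ → x̃ ↭ x̃′ →
             P -[ out x̃′ z ỹ ]→ P′
      ALPHA : ∀ {P P′ x̃ z ỹ a b} → P -[ out x̃ z ỹ ]→ P′ →
              a ∈ x̃ → sort a ≡ sort b → ¬ b ≡ z → b ∉ ỹ → b # P′ →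
              P -[ out (List.map (swapName a b) x̃) z (List.map (swapName a b) ỹ) ]→
              mapPi (swapName a b) P′

    data Op : ℕ → Set where
      𝟎      : Op 0
      inputᵒ : ∀ {n} (x : Name) (ỹ : Vec Name n) → Unique ỹ →
               ob (sort x) ≡ just (toList (Vec.map sort ỹ)) → Op 1
      output : (x : Name) (ỹ : List Name) → ob (sort x) ≡ just (List.map sort ỹ) → Op 1
      match  : (a b : Name) → Op 1
      νᵒ     : (x : Name) → Op 1
      rep    : Op 1
      par    : Op 2
      sum    : Op 2

    build : ∀ {k} → Op k → Vec Process k → Process
    build 𝟎                []                 = process 𝟎 ws-𝟎
    build (inputᵒ x ỹ u e) (process P v ∷ []) =
      process (input x ỹ P) (ws-input e (mapPi-WellSorted (abstr ỹ) (abstr-sort ỹ) v))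
    build (output x ỹ e)   (process P v ∷ []) = process (output x ỹ P) (ws-output e v)
    build (match a b)      (process P v ∷ []) = process (match a b P) (ws-match v)
    build (νᵒ x)           (process P v ∷ []) =
      process (ν x P) (ws-ν (mapPi-WellSorted (abstr (x ∷ [])) (abstr-sort (x ∷ [])) v))
    build rep              (process P v ∷ []) = process (! P) (ws-rep v)
    build par              (process P v ∷ process Q w ∷ []) = process (P ∣ Q) (ws-par v w)
    build sum              (process P v ∷ process Q w ∷ []) = process (P ⊕ Q) (ws-sum v w)

    map-act-sort : ∀ π {n} (ỹ : Vec Name n) →
                   Vec.map sort (Vec.map (act π) ỹ) ≡ Vec.map sort ỹ
    map-act-sort π ỹ =
      trans (sym (Vec.map-∘ sort (act π) ỹ)) (Vec.map-cong (act-sort π) ỹ)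

    swapOp : ∀ {k} → Swapping → Op k → Op k
    swapOp π 𝟎                = 𝟎
    swapOp π (inputᵒ x ỹ u e) =
      inputᵒ (act π x) (Vec.map (act π) ỹ) (Unique.map⁺ (act-injective π) u)
        (trans (cong ob (act-sort π x))
               (trans e (cong (just ∘ toList) (sym (map-act-sort π ỹ)))))
    swapOp π (output x ỹ e)   =
      output (act π x) (List.map (act π) ỹ) (map-ob (act π) (act-sort π) x ỹ e)
    swapOp π (match a b)      = match (act π a) (act π b)
    swapOp π (νᵒ x)           = νᵒ (act π x)
    swapOp π rep              = rep
    swapOp π par              = par
    swapOp π sum              = sum

  sortedPolyadicPi : ProcessCalculus
  sortedPolyadicPi = record
    { Proc     = SortedPi.Process
    ; _≈ₚ_     = λ P Q → SortedPi.term P ≡ SortedPi.term Q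
    ; swapProc = SortedPi.swapProcess
    ; Act      = SortedPi.Act
    ; _≈ₐ_     = SortedPi._≈ₐ_
    ; swapAct  = SortedPi.swapAct
    ; _-[_]→_  = λ P β P′ → SortedPi.term P SortedPi.-[ β ]→ SortedPi.term P′
    ; Op       = SortedPi.Op
    ; swapOp   = SortedPi.swapOp
    ; build    = SortedPi.build
    }

{-# OPTIONS --safe #-}
module Submission where

-- A pi process P is encoded by the agent ⟪ P ⟫ of the same shape: x(ỹ).P becomes an
-- input with pattern ⟨ỹ⟩, [a = b]P a case with the single branch a = b, and P + Q a case
-- with two branches ⊤.  The transitions of P and of ⟪ P ⟫ match each other, and the
-- derivatives of ⟪ P ⟫ are exactly the encodings of those of P, so that structural
-- congruence is needed only in its reflexive form.  The order of the bound names of an action, which PERM makes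
-- immaterial in the pi-calculus, is immaterial in SORTEDPPI because OPEN inserts its name
-- anywhere (PERM-admissible).
--
-- For completeness, a psi process A is decoded into a pi process P.  Well-formedness leaves
-- few differences between A and ⟪ P ⟫.  The pattern of an input may list the bound names in
-- another order, which only permutes the positions of the binder.  A case may have any
-- number of branches; it becomes a sum, in which a branch a = b is a match.  An assertion
-- becomes 𝟎.  A branch ⊥ can never act; it becomes a process which can never act either,
-- however its names are substituted: a sum of processes νx [x = v]𝟎, one for each free name
-- v of the branch.  Keeping these names makes the free names of P exactly those of A, so
-- the freshness side conditions of the two calculi agree.
--
-- Both situations are instances of one relation, Enc m srt P A: for m = canonical it is the
-- graph of ⟪_⟫ (canonical-unique), and for m = liberal it contains also the decodings above
-- (decode).  It is preserved by sort-preserving renaming (Enc-map), respects free names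
-- (Enc-fn⁺, Enc-fn⁻), and implies well-sortedness of both sides.  Related P and A simulate
-- each other, with related derivatives (forward, backward).  For m = canonical this is
-- operational correspondence.  For m = liberal it shows that psi processes related to a
-- common pi process are bisimilar; since this relation is closed under substitution, A
-- is congruent to the encoding ⟪ P ⟫ of any P that it is related to.

open import Defs

open import Data.Nat.Base using (zero; suc)
open import Data.Fin.Base using (Fin; zero; suc)
import Data.Fin.Properties as Fin
open import Data.Fin.Permutation as Perm
  using (Permutation; Permutation′; permutation; _⟨$⟩ʳ_; _⟨$⟩ˡ_; inverseˡ; inverseʳ; flip; ↔⇒≡)
open import Data.Maybe.Base using (just)
open import Data.List.Base as List using (List; []; _∷_; _++_)
import Data.List.Properties as List
open import Data.List.Membership.Propositional using (_∈_; _∉_)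
open import Data.List.Membership.Propositional.Properties
  using (∈-map⁺; ∈-map⁻; ∈-lookup; ∈-insert; ∈-∃++; ∈-tabulate⁺)
open import Data.List.Relation.Unary.Any using (here; there; index)
open import Data.List.Relation.Unary.Any.Properties using (lookup-index)
open import Data.List.Relation.Unary.All as All using (All; []; _∷_)
import Data.List.Relation.Unary.AllPairs as AllPairs
import Data.List.Relation.Unary.Unique.Propositional as ListUnique
import Data.List.Relation.Unary.Unique.Propositional.Properties as ListUnique
open import Data.List.Relation.Binary.Subset.Propositional using (_⊆_)
open import Data.List.Relation.Binary.Permutation.Propositional using (_↭_; ↭-sym; ↭-trans; ↭-refl)
open import Data.List.Relation.Binary.Permutation.Propositional.Properties as ↭
  using (↭-empty-inv; All-resp-↭; ∈-resp-↭; shift; drop-mid)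
open import Data.Vec.Base as Vec using (Vec; []; _∷_; toList; lookup; tabulate)
import Data.Vec.Properties as Vec
open import Data.Vec.Relation.Unary.Unique.Propositional using (Unique)
import Data.Vec.Relation.Unary.Unique.Propositional.Properties as Unique
open import Data.Product.Base using (Σ-syntax; ∃-syntax; _×_; _,_; proj₁; proj₂)
open import Data.Sum.Base as Sum using (_⊎_; inj₁; inj₂; [_,_])
open import Function.Base using (id; _∘_)
open import Relation.Nullary using (¬_; yes; no; contradiction)
open import Relation.Binary.PropositionalEquality
  using (_≡_; _≢_; refl; sym; trans; cong; cong₂; subst; subst₂; module ≡-Reasoning)

-- Lists and permutations

cong₃ : {A B C D : Set} (f : A → B → C → D) {a a′ : A} {b b′ : B} {c c′ : C} →
        a ≡ a′ → b ≡ b′ → c ≡ c′ → f a b c ≡ f a′ b′ c′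
cong₃ f refl refl refl = refl

toList-tabulate : ∀ {n} {A : Set} (f : Fin n → A) → toList (tabulate f) ≡ List.tabulate f
toList-tabulate {zero}  f = refl
toList-tabulate {suc n} f = cong (f zero ∷_) (toList-tabulate (f ∘ suc))

list-lookup-injective : ∀ {A : Set} {xs : List A} → ListUnique.Unique xs → ∀ i j →
                        List.lookup xs i ≡ List.lookup xs j → i ≡ j
list-lookup-injective (_ AllPairs.∷ _)  zero    zero    _ = refl
list-lookup-injective (x∉ AllPairs.∷ _) zero    (suc j) e =
  contradiction e (All.lookup x∉ (∈-lookup j))
list-lookup-injective (x∉ AllPairs.∷ _) (suc i) zero    e =
  contradiction (sym e) (All.lookup x∉ (∈-lookup i))
list-lookup-injective (_ AllPairs.∷ u)  (suc i) (suc j) e =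
  cong suc (list-lookup-injective u i j e)

-- A repetition-free list of all the elements of Fin n is a permutation of Fin n.
enumeration : ∀ {n} {is : List (Fin n)} → ListUnique.Unique is → (∀ i → i ∈ is) →
              Σ[ ρ ∈ Permutation′ n ] is ≡ List.tabulate (ρ ⟨$⟩ˡ_)
enumeration {n} {is} u all = as-permutation π (sym (List.tabulate-lookup is))
  where
  π : Permutation n (List.length is)
  π = permutation (λ i → index (all i)) (List.lookup is)
        (λ j → list-lookup-injective u _ j (sym (lookup-index (all (List.lookup is j)))))
        (λ i → sym (lookup-index (all i)))

  as-permutation : ∀ {m} (π : Permutation n m) → is ≡ List.tabulate (π ⟨$⟩ˡ_) →
                   Σ[ ρ ∈ Permutation′ n ] is ≡ List.tabulate (ρ ⟨$⟩ˡ_)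
  as-permutation π e with ↔⇒≡ π
  ... | refl = π , e

vec-ext : ∀ {n} {A : Set} {xs ys : Vec A n} → (∀ i → lookup xs i ≡ lookup ys i) → xs ≡ ys
vec-ext {xs = xs} {ys} h =
  trans (sym (Vec.tabulate∘lookup xs)) (trans (Vec.tabulate-cong h) (Vec.tabulate∘lookup ys))

toList-inj : ∀ {n} {A : Set} {xs ys : Vec A n} → toList xs ≡ toList ys → xs ≡ ys
toList-inj {xs = xs} {ys} e =
  trans (sym (Vec.cast-is-id refl xs)) (Vec.toList-injective refl xs ys e)

module Encoding (Sig : Signature) where
  open Signature Sig
  open Calculi Sig
  private
    module Π = SortedPi

  open Ψ using (Agent; Cond; Guarded; WF; _⊢_; ⊢⊤; ⊢≐; 𝟏; ⊤ᶜ; ⊥ᶜ; _≐_; name; ⟨_⟩; _·_)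
  open Π using (Pi; WellSorted)
  open Ψ.Agent
  open Ψ.Guarded
  open Ψ.WF
  open Π.Pi
  open Π.WellSorted

  private variable
    V W U : Set

  -- Renaming and free names

  map-agree : {A B C : Set} {f : B → C} {g : A → B} {h : A → C} → (∀ v → f (g v) ≡ h v) →
              ∀ xs → List.map f (List.map g xs) ≡ List.map h xs
  map-agree e xs = trans (sym (List.map-∘ xs)) (List.map-cong e xs)

  map₂-agree : ∀ {A : Set} {f : W → U} {g : V → W} {h : V → U} → (∀ v → f (g v) ≡ h v) →
               (r : A ⊎ V) → Sum.map₂ f (Sum.map₂ g r) ≡ Sum.map₂ h r
  map₂-agree e (inj₁ i) = refl
  map₂-agree e (inj₂ v) = cong inj₂ (e v)

  mapPi-∘ : {f : W → U} {g : V → W} {h : V → U} → (∀ v → f (g v) ≡ h v) →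
            ∀ P → Π.mapPi f (Π.mapPi g P) ≡ Π.mapPi h P
  mapPi-∘ e 𝟎              = refl
  mapPi-∘ e (input′ x Δ P) = cong₂ (λ y → input′ y Δ) (e x) (mapPi-∘ (map₂-agree e) P)
  mapPi-∘ e (output x ỹ P) = cong₃ output (e x) (map-agree e ỹ) (mapPi-∘ e P)
  mapPi-∘ e (match a b P)  = cong₃ match (e a) (e b) (mapPi-∘ e P)
  mapPi-∘ e (ν′ s P) = cong (ν′ s) (mapPi-∘ (map₂-agree e) P)
  mapPi-∘ e (! P)    = cong !_ (mapPi-∘ e P)
  mapPi-∘ e (P ∣ Q)  = cong₂ _∣_ (mapPi-∘ e P) (mapPi-∘ e Q)
  mapPi-∘ e (P ⊕ Q)  = cong₂ _⊕_ (mapPi-∘ e P) (mapPi-∘ e Q)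

  mapTerm-∘ : {f : W → U} {g : V → W} {h : V → U} → (∀ v → f (g v) ≡ h v) →
              ∀ M → Ψ.mapTerm f (Ψ.mapTerm g M) ≡ Ψ.mapTerm h M
  mapTerm-∘ e (name a) = cong name (e a)
  mapTerm-∘ e ⟨ ã ⟩    = cong ⟨_⟩ (map-agree e ã)

  mapCond-∘ : {f : W → U} {g : V → W} {h : V → U} → (∀ v → f (g v) ≡ h v) →
              ∀ φ → Ψ.mapCond f (Ψ.mapCond g φ) ≡ Ψ.mapCond h φ
  mapCond-∘ e ⊤ᶜ      = refl
  mapCond-∘ e ⊥ᶜ      = refl
  mapCond-∘ e (a ≐ b) = cong₂ _≐_ (e a) (e b)

  mapAgent-∘ : {f : W → U} {g : V → W} {h : V → U} → (∀ v → f (g v) ≡ h v) →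
               ∀ A → Ψ.mapAgent f (Ψ.mapAgent g A) ≡ Ψ.mapAgent h A
  mapBranches-∘ : {f : W → U} {g : V → W} {h : V → U} → (∀ v → f (g v) ≡ h v) →
                  ∀ bs → Ψ.mapBranches f (Ψ.mapBranches g bs) ≡ Ψ.mapBranches h bs
  mapAgent-∘ e (output M N A) = cong₃ output (mapTerm-∘ e M) (mapTerm-∘ e N) (mapAgent-∘ e A)
  mapAgent-∘ e (input′ M Δ X A) =
    cong₃ (λ M → input′ M Δ) (mapTerm-∘ e M) (map-agree (map₂-agree e) X)
          (mapAgent-∘ (map₂-agree e) A)
  mapAgent-∘ e (case bs) = cong case (mapBranches-∘ e bs)
  mapAgent-∘ e (ν′ s A)  = cong (ν′ s) (mapAgent-∘ (map₂-agree e) A)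
  mapAgent-∘ e (A ∣ B)   = cong₂ _∣_ (mapAgent-∘ e A) (mapAgent-∘ e B)
  mapAgent-∘ e (! A)     = cong !_ (mapAgent-∘ e A)
  mapAgent-∘ e ⦅ Ψ ⦆     = refl
  mapBranches-∘ e []             = refl
  mapBranches-∘ e ((φ , A) ∷ bs) =
    cong₂ _∷_ (cong₂ _,_ (mapCond-∘ e φ) (mapAgent-∘ e A)) (mapBranches-∘ e bs)

  map-fixed : {A : Set} {f : A → A} → ∀ xs → (∀ {v} → v ∈ xs → f v ≡ v) → List.map f xs ≡ xs
  map-fixed []       h = refl
  map-fixed (x ∷ xs) h = cong₂ _∷_ (h (here refl)) (map-fixed xs (h ∘ there))

  map₂-fixed : {A : Set} {f : V → V} {p : A ⊎ V → Set} →
               (∀ {v} → p (inj₂ v) → f v ≡ v) → ∀ {r} → p r → Sum.map₂ f r ≡ r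
  map₂-fixed h {inj₁ i} _ = refl
  map₂-fixed h {inj₂ v} q = cong inj₂ (h q)

  -- Only the free names have to be fixed.
  mapPi-fixed : {f : V → V} → ∀ P → (∀ {v} → v Π.∈fn P → f v ≡ v) → Π.mapPi f P ≡ P
  mapPi-fixed 𝟎              h = refl
  mapPi-fixed (input′ x Δ P) h =
    cong₂ (λ y → input′ y Δ) (h (inj₁ refl))
      (mapPi-fixed P (map₂-fixed {p = Π._∈fn P} (h ∘ inj₂)))
  mapPi-fixed (output x ỹ P) h =
    cong₃ output (h (inj₁ refl)) (map-fixed ỹ (h ∘ inj₂ ∘ inj₁))
          (mapPi-fixed P (h ∘ inj₂ ∘ inj₂))
  mapPi-fixed (match a b P) h =
    cong₃ match (h (inj₁ refl)) (h (inj₂ (inj₁ refl))) (mapPi-fixed P (h ∘ inj₂ ∘ inj₂))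
  mapPi-fixed (ν′ s P) h = cong (ν′ s) (mapPi-fixed P (map₂-fixed {p = Π._∈fn P} h))
  mapPi-fixed (! P)    h = cong !_ (mapPi-fixed P h)
  mapPi-fixed (P ∣ Q)  h = cong₂ _∣_ (mapPi-fixed P (h ∘ inj₁)) (mapPi-fixed Q (h ∘ inj₂))
  mapPi-fixed (P ⊕ Q)  h = cong₂ _⊕_ (mapPi-fixed P (h ∘ inj₁)) (mapPi-fixed Q (h ∘ inj₂))

  mapTerm-fixed : {f : V → V} → ∀ M → (∀ {v} → v ∈ Ψ.names M → f v ≡ v) → Ψ.mapTerm f M ≡ M
  mapTerm-fixed (name a) h = cong name (h (here refl))
  mapTerm-fixed ⟨ ã ⟩    h = cong ⟨_⟩ (map-fixed ã h)

  mapCond-fixed : {f : V → V} → ∀ φ → (∀ {v} → v ∈ Ψ.condNames φ → f v ≡ v) →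
                  Ψ.mapCond f φ ≡ φ
  mapCond-fixed ⊤ᶜ      h = refl
  mapCond-fixed ⊥ᶜ      h = refl
  mapCond-fixed (a ≐ b) h = cong₂ _≐_ (h (here refl)) (h (there (here refl)))

  mapAgent-fixed : {f : V → V} → ∀ A → (∀ {v} → v Ψ.∈fn A → f v ≡ v) → Ψ.mapAgent f A ≡ A
  mapBranches-fixed : {f : V → V} → ∀ bs → (∀ {v} → v Ψ.∈fnᵇ bs → f v ≡ v) →
                      Ψ.mapBranches f bs ≡ bs
  mapAgent-fixed (output M N A) h =
    cong₃ output (mapTerm-fixed M (h ∘ inj₁)) (mapTerm-fixed N (h ∘ inj₂ ∘ inj₁))
          (mapAgent-fixed A (h ∘ inj₂ ∘ inj₂))
  mapAgent-fixed (input′ M Δ X A) h =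
    cong₃ (λ M → input′ M Δ) (mapTerm-fixed M (h ∘ inj₁))
          (map-fixed X (map₂-fixed {p = _∈ X} (h ∘ inj₂ ∘ inj₁)))
          (mapAgent-fixed A (map₂-fixed {p = Ψ._∈fn A} (h ∘ inj₂ ∘ inj₂)))
  mapAgent-fixed (case bs) h = cong case (mapBranches-fixed bs h)
  mapAgent-fixed (ν′ s A)  h = cong (ν′ s) (mapAgent-fixed A (map₂-fixed {p = Ψ._∈fn A} h))
  mapAgent-fixed (A ∣ B)   h =
    cong₂ _∣_ (mapAgent-fixed A (h ∘ inj₁)) (mapAgent-fixed B (h ∘ inj₂))
  mapAgent-fixed (! A)     h = cong !_ (mapAgent-fixed A h)
  mapAgent-fixed ⦅ Ψ ⦆     h = refl
  mapBranches-fixed []             h = refl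
  mapBranches-fixed ((φ , A) ∷ bs) h =
    cong₂ _∷_ (cong₂ _,_ (mapCond-fixed φ (h ∘ inj₁)) (mapAgent-fixed A (h ∘ inj₂ ∘ inj₁)))
              (mapBranches-fixed bs (h ∘ inj₂ ∘ inj₂))

  mapAgent-cong : {f g : V → W} → (∀ v → f v ≡ g v) → ∀ A → Ψ.mapAgent f A ≡ Ψ.mapAgent g A
  mapAgent-cong {f = f} e A =
    trans (cong (Ψ.mapAgent f) (sym (mapAgent-fixed {f = id} A (λ _ → refl)))) (mapAgent-∘ e A)

  -- A preimage of a free name under a renaming below a binder is again free.
  under : {A : Set} {f : V → W} {p : A ⊎ V → Set} {w : W} →
          Σ[ r ∈ A ⊎ V ] p r × inj₂ w ≡ Sum.map₂ f r → Σ[ v ∈ V ] p (inj₂ v) × w ≡ f v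
  under (inj₂ v , q , refl) = v , q , refl

  map-preimage : {f : V → W} {p q : V → Set} {w : W} → (∀ {v} → p v → q v) →
         Σ[ v ∈ V ] p v × w ≡ f v → Σ[ v ∈ V ] q v × w ≡ f v
  map-preimage h (v , m , e) = v , h m , e

  mapPi-fn⁻ : {f : V → W} → ∀ P {w} → w Π.∈fn Π.mapPi f P → Σ[ v ∈ V ] v Π.∈fn P × w ≡ f v
  mapPi-fn⁻ (input′ x Δ P) (inj₁ e) = x , inj₁ refl , e
  mapPi-fn⁻ (input′ x Δ P) (inj₂ m) =
    map-preimage inj₂ (under {p = Π._∈fn P} (mapPi-fn⁻ P m))
  mapPi-fn⁻ (output x ỹ P) (inj₁ e)        = x , inj₁ refl , e
  mapPi-fn⁻ {f = f} (output x ỹ P) (inj₂ (inj₁ m)) = map-preimage (inj₂ ∘ inj₁) (∈-map⁻ f m)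
  mapPi-fn⁻ (output x ỹ P) (inj₂ (inj₂ m)) = map-preimage (inj₂ ∘ inj₂) (mapPi-fn⁻ P m)
  mapPi-fn⁻ (match a b P) (inj₁ e)         = a , inj₁ refl , e
  mapPi-fn⁻ (match a b P) (inj₂ (inj₁ e))  = b , inj₂ (inj₁ refl) , e
  mapPi-fn⁻ (match a b P) (inj₂ (inj₂ m))  = map-preimage (inj₂ ∘ inj₂) (mapPi-fn⁻ P m)
  mapPi-fn⁻ (ν′ s P) m        = under {p = Π._∈fn P} (mapPi-fn⁻ P m)
  mapPi-fn⁻ (! P)    m        = mapPi-fn⁻ P m
  mapPi-fn⁻ (P ∣ Q)  (inj₁ m) = map-preimage inj₁ (mapPi-fn⁻ P m)
  mapPi-fn⁻ (P ∣ Q)  (inj₂ m) = map-preimage inj₂ (mapPi-fn⁻ Q m)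
  mapPi-fn⁻ (P ⊕ Q)  (inj₁ m) = map-preimage inj₁ (mapPi-fn⁻ P m)
  mapPi-fn⁻ (P ⊕ Q)  (inj₂ m) = map-preimage inj₂ (mapPi-fn⁻ Q m)

  mapPi-fn⁺ : (f : V → W) → ∀ P {v} → v Π.∈fn P → f v Π.∈fn Π.mapPi f P
  mapPi-fn⁺ f (input′ x Δ P) = Sum.map (cong f) (mapPi-fn⁺ _ P)
  mapPi-fn⁺ f (output x ỹ P) = Sum.map (cong f) (Sum.map (∈-map⁺ f) (mapPi-fn⁺ f P))
  mapPi-fn⁺ f (match a b P)  = Sum.map (cong f) (Sum.map (cong f) (mapPi-fn⁺ f P))
  mapPi-fn⁺ f (ν′ s P)       = mapPi-fn⁺ _ P
  mapPi-fn⁺ f (! P)          = mapPi-fn⁺ f P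
  mapPi-fn⁺ f (P ∣ Q)        = Sum.map (mapPi-fn⁺ f P) (mapPi-fn⁺ f Q)
  mapPi-fn⁺ f (P ⊕ Q)        = Sum.map (mapPi-fn⁺ f P) (mapPi-fn⁺ f Q)

  mapTerm-names⁻ : {f : V → W} → ∀ M {w} → w ∈ Ψ.names (Ψ.mapTerm f M) →
                   Σ[ v ∈ V ] v ∈ Ψ.names M × w ≡ f v
  mapTerm-names⁻ {f = f} (name a) m = ∈-map⁻ f {xs = a ∷ []} m
  mapTerm-names⁻ {f = f} ⟨ ã ⟩    m = ∈-map⁻ f m

  mapTerm-names⁺ : (f : V → W) → ∀ M {v} → v ∈ Ψ.names M → f v ∈ Ψ.names (Ψ.mapTerm f M)
  mapTerm-names⁺ f (name a) m = ∈-map⁺ f {xs = a ∷ []} m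
  mapTerm-names⁺ f ⟨ ã ⟩    m = ∈-map⁺ f m

  mapCond-names⁻ : {f : V → W} → ∀ φ {w} → w ∈ Ψ.condNames (Ψ.mapCond f φ) →
                   Σ[ v ∈ V ] v ∈ Ψ.condNames φ × w ≡ f v
  mapCond-names⁻ {f = f} (a ≐ b) m = ∈-map⁻ f {xs = a ∷ b ∷ []} m

  mapCond-names⁺ : (f : V → W) → ∀ φ {v} → v ∈ Ψ.condNames φ →
                   f v ∈ Ψ.condNames (Ψ.mapCond f φ)
  mapCond-names⁺ f (a ≐ b) m = ∈-map⁺ f {xs = a ∷ b ∷ []} m

  mapAgent-fn⁻ : {f : V → W} → ∀ A {w} → w Ψ.∈fn Ψ.mapAgent f A →
                 Σ[ v ∈ V ] v Ψ.∈fn A × w ≡ f v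
  mapBranches-fn⁻ : {f : V → W} → ∀ bs {w} → w Ψ.∈fnᵇ Ψ.mapBranches f bs →
                    Σ[ v ∈ V ] v Ψ.∈fnᵇ bs × w ≡ f v
  mapAgent-fn⁻ (output M N A) (inj₁ m)        = map-preimage inj₁ (mapTerm-names⁻ M m)
  mapAgent-fn⁻ (output M N A) (inj₂ (inj₁ m)) = map-preimage (inj₂ ∘ inj₁) (mapTerm-names⁻ N m)
  mapAgent-fn⁻ (output M N A) (inj₂ (inj₂ m)) = map-preimage (inj₂ ∘ inj₂) (mapAgent-fn⁻ A m)
  mapAgent-fn⁻ (input′ M Δ X A) (inj₁ m)      = map-preimage inj₁ (mapTerm-names⁻ M m)
  mapAgent-fn⁻ (input′ M Δ X A) (inj₂ (inj₁ m)) =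
    map-preimage (inj₂ ∘ inj₁) (under {p = _∈ X} (∈-map⁻ _ m))
  mapAgent-fn⁻ (input′ M Δ X A) (inj₂ (inj₂ m)) =
    map-preimage (inj₂ ∘ inj₂) (under {p = Ψ._∈fn A} (mapAgent-fn⁻ A m))
  mapAgent-fn⁻ (case bs) m        = mapBranches-fn⁻ bs m
  mapAgent-fn⁻ (ν′ s A)  m        = under {p = Ψ._∈fn A} (mapAgent-fn⁻ A m)
  mapAgent-fn⁻ (A ∣ B)   (inj₁ m) = map-preimage inj₁ (mapAgent-fn⁻ A m)
  mapAgent-fn⁻ (A ∣ B)   (inj₂ m) = map-preimage inj₂ (mapAgent-fn⁻ B m)
  mapAgent-fn⁻ (! A)     m        = mapAgent-fn⁻ A m
  mapBranches-fn⁻ ((φ , A) ∷ bs) (inj₁ m)        = map-preimage inj₁ (mapCond-names⁻ φ m)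
  mapBranches-fn⁻ ((φ , A) ∷ bs) (inj₂ (inj₁ m)) = map-preimage (inj₂ ∘ inj₁) (mapAgent-fn⁻ A m)
  mapBranches-fn⁻ ((φ , A) ∷ bs) (inj₂ (inj₂ m)) = map-preimage (inj₂ ∘ inj₂) (mapBranches-fn⁻ bs m)

  mapAgent-fn⁺ : (f : V → W) → ∀ A {v} → v Ψ.∈fn A → f v Ψ.∈fn Ψ.mapAgent f A
  mapBranches-fn⁺ : (f : V → W) → ∀ bs {v} → v Ψ.∈fnᵇ bs → f v Ψ.∈fnᵇ Ψ.mapBranches f bs
  mapAgent-fn⁺ f (output M N A)   =
    Sum.map (mapTerm-names⁺ f M) (Sum.map (mapTerm-names⁺ f N) (mapAgent-fn⁺ f A))
  mapAgent-fn⁺ f (input′ M Δ X A) =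
    Sum.map (mapTerm-names⁺ f M) (Sum.map (∈-map⁺ _) (mapAgent-fn⁺ _ A))
  mapAgent-fn⁺ f (case bs)        = mapBranches-fn⁺ f bs
  mapAgent-fn⁺ f (ν′ s A)         = mapAgent-fn⁺ _ A
  mapAgent-fn⁺ f (A ∣ B)          = Sum.map (mapAgent-fn⁺ f A) (mapAgent-fn⁺ f B)
  mapAgent-fn⁺ f (! A)            = mapAgent-fn⁺ f A
  mapBranches-fn⁺ f ((φ , A) ∷ bs) =
    Sum.map (mapCond-names⁺ f φ) (Sum.map (mapAgent-fn⁺ f A) (mapBranches-fn⁺ f bs))

  -- Abstraction of names and its inverse

  -- Concretion, the left inverse of abstr x̃: it puts the names x̃ for the bound positions.
  inst : ∀ {n} → Vec Name n → Fin n ⊎ Name → Name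
  inst x̃ = [ lookup x̃ , id ]

  inst-sort : ∀ {n} (x̃ : Vec Name n) r → sort (inst x̃ r) ≡ ext (Vec.map sort x̃) sort r
  inst-sort x̃ (inj₁ i) = sym (Vec.lookup-map i sort x̃)
  inst-sort x̃ (inj₂ c) = refl

  :=-abstr : ∀ {n} (x̃ z̃ : Vec Name n) c → (x̃ := z̃) c ≡ inst z̃ (abstr x̃ c)
  :=-abstr []      []      c = refl
  :=-abstr (x ∷ x̃) (z ∷ z̃) c with c ≟ x
  ... | yes _ = refl
  ... | no  _ with abstr x̃ c | :=-abstr x̃ z̃ c
  ...   | inj₁ i | e = e
  ...   | inj₂ d | e = e

  inst-abstr : ∀ {n} (x̃ : Vec Name n) c → inst x̃ (abstr x̃ c) ≡ c
  inst-abstr []      c = refl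
  inst-abstr (x ∷ x̃) c with c ≟ x
  ... | yes refl = refl
  ... | no  _ with abstr x̃ c | inst-abstr x̃ c
  ...   | inj₁ i | e = e
  ...   | inj₂ d | e = e

  abstr-fresh : ∀ {n} (x̃ : Vec Name n) {c} → (∀ i → c ≢ lookup x̃ i) → abstr x̃ c ≡ inj₂ c
  abstr-fresh []      h = refl
  abstr-fresh (x ∷ x̃) {c} h with c ≟ x
  ... | yes c≡x = contradiction c≡x (h zero)
  ... | no  _   = cong (Sum.map₁ suc) (abstr-fresh x̃ (h ∘ suc))

  abstr-lookup : ∀ {n} {x̃ : Vec Name n} → Unique x̃ → ∀ i → abstr x̃ (lookup x̃ i) ≡ inj₁ i
  abstr-lookup {x̃ = x̃} u i with abstr x̃ (lookup x̃ i) in eq | inst-abstr x̃ (lookup x̃ i)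
  ... | inj₁ j | e = cong inj₁ (Unique.lookup-injective u j i e)
  ... | inj₂ d | refl = contradiction eq (bound x̃ i)
    where
    bound : ∀ {n} (x̃ : Vec Name n) i {d} → abstr x̃ (lookup x̃ i) ≢ inj₂ d
    bound (x ∷ x̃) zero e with x ≟ x
    bound (x ∷ x̃) zero () | yes _
    ... | no x≢x = x≢x refl
    bound (x ∷ x̃) (suc i) e with lookup x̃ i ≟ x
    bound (x ∷ x̃) (suc i) () | yes _
    ... | no _ with abstr x̃ (lookup x̃ i) in eq
    ...   | inj₂ d = bound x̃ i eq
    bound (x ∷ x̃) (suc i) () | no _ | inj₁ _

  -- Permutations of tuples and of binder positions.  Position i of ρ · x̃ holds the name at
  -- position ρ ⟨$⟩ʳ i of x̃, so binding ρ · x̃ instead of x̃ sends position i to ρ ⟨$⟩ˡ i.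

  lookup-· : ∀ {n} {A : Set} (ρ : Permutation′ n) (xs : Vec A n) i →
             lookup (ρ · xs) i ≡ lookup xs (ρ ⟨$⟩ʳ i)
  lookup-· ρ xs = Vec.lookup∘tabulate _

  lookup-·ˡ : ∀ {n} {A : Set} (ρ : Permutation′ n) (xs : Vec A n) i →
              lookup (ρ · xs) (ρ ⟨$⟩ˡ i) ≡ lookup xs i
  lookup-·ˡ ρ xs i = trans (lookup-· ρ xs _) (cong (lookup xs) (inverseʳ ρ))

  ·-flip : ∀ {n} {A : Set} (ρ : Permutation′ n) (xs : Vec A n) → ρ · (flip ρ · xs) ≡ xs
  ·-flip ρ xs = vec-ext λ i → trans (lookup-· ρ (flip ρ · xs) i)
    (trans (lookup-· (flip ρ) xs _) (cong (lookup xs) (inverseˡ ρ)))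

  map-· : ∀ {n} {A B : Set} (f : A → B) (ρ : Permutation′ n) (xs : Vec A n) →
          Vec.map f (ρ · xs) ≡ ρ · Vec.map f xs
  map-· f ρ xs = trans (sym (Vec.tabulate-∘ f _))
    (Vec.tabulate-cong λ i → sym (Vec.lookup-map (ρ ⟨$⟩ʳ i) f xs))

  ·-injective : ∀ {n} {A : Set} (ρ : Permutation′ n) {xs ys : Vec A n} →
                ρ · xs ≡ ρ · ys → xs ≡ ys
  ·-injective ρ {xs} {ys} e = vec-ext λ i →
    trans (sym (lookup-·ˡ ρ xs i)) (trans (cong (λ zs → lookup zs (ρ ⟨$⟩ˡ i)) e) (lookup-·ˡ ρ ys i))

  Unique-· : ∀ {n} (ρ : Permutation′ n) {xs : Vec Name n} → Unique xs → Unique (ρ · xs)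
  Unique-· ρ {xs} u = Unique.tabulate⁺ λ {i} {j} e →
    trans (sym (inverseˡ ρ)) (trans (cong (ρ ⟨$⟩ˡ_) (Unique.lookup-injective u _ _ e)) (inverseˡ ρ))

  Unique-·⁻ : ∀ {n} (ρ : Permutation′ n) {xs : Vec Name n} → Unique (ρ · xs) → Unique xs
  Unique-·⁻ ρ {xs} u = subst Unique (·-flip (flip ρ) xs) (Unique-· (flip ρ) u)

  abstr-· : ∀ {n} (ρ : Permutation′ n) {x̃ : Vec Name n} → Unique x̃ → ∀ c →
            Sum.map₁ (ρ ⟨$⟩ˡ_) (abstr x̃ c) ≡ abstr (ρ · x̃) c
  abstr-· ρ {x̃} u c with Fin.any? (λ i → c ≟ lookup x̃ i)
  ... | yes (i , refl) = begin
    Sum.map₁ (ρ ⟨$⟩ˡ_) (abstr x̃ (lookup x̃ i))        ≡⟨ cong (Sum.map₁ _) (abstr-lookup u i) ⟩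
    inj₁ (ρ ⟨$⟩ˡ i)                                   ≡⟨ abstr-lookup (Unique-· ρ u) _ ⟨
    abstr (ρ · x̃) (lookup (ρ · x̃) (ρ ⟨$⟩ˡ i))         ≡⟨ cong (abstr (ρ · x̃)) (lookup-·ˡ ρ x̃ i) ⟩
    abstr (ρ · x̃) (lookup x̃ i)                        ∎
    where open ≡-Reasoning
  ... | no fresh = trans (cong (Sum.map₁ _) (abstr-fresh x̃ (λ i e → fresh (i , e))))
    (sym (abstr-fresh (ρ · x̃) (λ i e → fresh (_ , trans e (lookup-· ρ x̃ i)))))

  :=-· : ∀ {n} (ρ : Permutation′ n) {x̃ : Vec Name n} (z̃ : Vec Name n) → Unique x̃ → ∀ c →
         (ρ · x̃ := ρ · z̃) c ≡ (x̃ := z̃) c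
  :=-· ρ {x̃} z̃ u c = begin
    (ρ · x̃ := ρ · z̃) c                                 ≡⟨ :=-abstr (ρ · x̃) (ρ · z̃) c ⟩
    inst (ρ · z̃) (abstr (ρ · x̃) c)                     ≡⟨ cong (inst (ρ · z̃)) (abstr-· ρ u c) ⟨
    inst (ρ · z̃) (Sum.map₁ (ρ ⟨$⟩ˡ_) (abstr x̃ c))      ≡⟨ permute (abstr x̃ c) ⟩
    inst z̃ (abstr x̃ c)                                 ≡⟨ :=-abstr x̃ z̃ c ⟨
    (x̃ := z̃) c                                         ∎
    where
    open ≡-Reasoning
    permute : ∀ r → inst (ρ · z̃) (Sum.map₁ (ρ ⟨$⟩ˡ_) r) ≡ inst z̃ r
    permute (inj₁ i) = lookup-·ˡ ρ z̃ i
    permute (inj₂ d) = refl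

  -- The pattern ⟨x̃⟩ below a binder for ρ · x̃.
  permutedPattern : ∀ {n} → Permutation′ n → Ψ.Pattern (Fin n ⊎ V)
  permutedPattern ρ = toList (tabulate (inj₁ ∘ (ρ ⟨$⟩ˡ_)))

  map-pattern : ∀ {n} {A : Set} (ρ : Permutation′ n) (f : Fin n ⊎ V → A) →
                List.map f (permutedPattern ρ) ≡ toList (tabulate (f ∘ inj₁ ∘ (ρ ⟨$⟩ˡ_)))
  map-pattern ρ f = trans (sym (Vec.toList-map f (tabulate (inj₁ ∘ (ρ ⟨$⟩ˡ_)))))
                          (cong toList (sym (Vec.tabulate-∘ f _)))

  pattern-sorts : ∀ {n} (ρ : Permutation′ n) (Δ : Vec Subject n) (srt : V → Subject) →
                  List.map (ext (ρ · Δ) srt) (permutedPattern ρ) ≡ toList Δ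
  pattern-sorts ρ Δ srt = trans (map-pattern ρ (ext (ρ · Δ) srt))
    (cong toList (trans (Vec.tabulate-cong (lookup-·ˡ ρ Δ)) (Vec.tabulate∘lookup Δ)))

  abstr-pattern : ∀ {n} (ρ : Permutation′ n) {x̃ : Vec Name n} → Unique x̃ →
                  List.map (abstr (ρ · x̃)) (toList x̃) ≡ permutedPattern ρ
  abstr-pattern ρ {x̃} u = trans (sym (Vec.toList-map _ x̃)) (cong toList (vec-ext λ i → begin
    lookup (Vec.map (abstr (ρ · x̃)) x̃) i              ≡⟨ Vec.lookup-map i _ x̃ ⟩
    abstr (ρ · x̃) (lookup x̃ i)                        ≡⟨ cong (abstr (ρ · x̃)) (lookup-·ˡ ρ x̃ i) ⟨
    abstr (ρ · x̃) (lookup (ρ · x̃) (ρ ⟨$⟩ˡ i))         ≡⟨ abstr-lookup (Unique-· ρ u) _ ⟩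
    inj₁ (ρ ⟨$⟩ˡ i)                                   ≡⟨ Vec.lookup∘tabulate _ i ⟨
    lookup (tabulate (inj₁ ∘ (ρ ⟨$⟩ˡ_))) i            ∎))
    where open ≡-Reasoning

  -- A pattern ⟨ỹ⟩ which takes this form below a binder for x̃ determines x̃.
  abstr-pattern⁻ : ∀ {n} (ρ : Permutation′ n) {x̃ ỹ : Vec Name n} →
                   List.map (abstr x̃) (toList ỹ) ≡ permutedPattern ρ → x̃ ≡ ρ · ỹ
  abstr-pattern⁻ ρ {x̃} {ỹ} e = vec-ext λ i → begin
    lookup x̃ i                                    ≡⟨ cong (lookup x̃) (inverseˡ ρ) ⟨
    inst x̃ (inj₁ (ρ ⟨$⟩ˡ (ρ ⟨$⟩ʳ i)))             ≡⟨ cong (inst x̃) (at (ρ ⟨$⟩ʳ i)) ⟨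
    inst x̃ (abstr x̃ (lookup ỹ (ρ ⟨$⟩ʳ i)))        ≡⟨ inst-abstr x̃ _ ⟩
    lookup ỹ (ρ ⟨$⟩ʳ i)                           ≡⟨ lookup-· ρ ỹ i ⟨
    lookup (ρ · ỹ) i                              ∎
    where
    open ≡-Reasoning
    at : ∀ i → abstr x̃ (lookup ỹ i) ≡ inj₁ (ρ ⟨$⟩ˡ i)
    at i = begin
      abstr x̃ (lookup ỹ i)                          ≡⟨ Vec.lookup-map i _ ỹ ⟨
      lookup (Vec.map (abstr x̃) ỹ) i
        ≡⟨ cong (λ v → lookup v i) (toList-inj (trans (Vec.toList-map _ ỹ) e)) ⟩
      lookup (tabulate (inj₁ ∘ (ρ ⟨$⟩ˡ_))) i        ≡⟨ Vec.lookup∘tabulate _ i ⟩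
      inj₁ (ρ ⟨$⟩ˡ i)                               ∎

  map₁-flip : ∀ {n} (ρ : Permutation′ n) (r : Fin n ⊎ V) →
              Sum.map₁ (ρ ⟨$⟩ˡ_) (Sum.map₁ (ρ ⟨$⟩ʳ_) r) ≡ r
  map₁-flip ρ (inj₁ i) = cong inj₁ (inverseˡ ρ)
  map₁-flip ρ (inj₂ v) = refl

  mapAgent-flip : ∀ {n} (ρ : Permutation′ n) (A : Agent (Fin n ⊎ V)) →
                  Ψ.mapAgent (Sum.map₁ (ρ ⟨$⟩ˡ_)) (Ψ.mapAgent (Sum.map₁ (ρ ⟨$⟩ʳ_)) A) ≡ A
  mapAgent-flip ρ A = trans (mapAgent-∘ (map₁-flip ρ) A) (mapAgent-fixed {f = id} A (λ _ → refl))

  -- On a tuple of distinct names, two permutations agree only if they are equal.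
  ·-agree : ∀ {n} {A : Set} {π ρ : Permutation′ n} {x̃ : Vec Name n} → Unique x̃ →
            π · x̃ ≡ ρ · x̃ → (xs : Vec A n) → π · xs ≡ ρ · xs
  ·-agree {π = π} {ρ} {x̃} u e xs = Vec.tabulate-cong λ i → cong (lookup xs)
    (Unique.lookup-injective u _ _
      (trans (sym (lookup-· π x̃ i)) (trans (cong (λ v → lookup v i) e) (lookup-· ρ x̃ i))))

  -- An input body with binder ρ · x̃, its positions moved back to the order of x̃.
  unpermute : ∀ {n} (ρ : Permutation′ n) {x̃ : Vec Name n} {A B} → Unique x̃ →
              Ψ.mapAgent (abstr (ρ · x̃)) A ≡ Ψ.mapAgent (Sum.map₁ (ρ ⟨$⟩ˡ_)) B →
              B ≡ Ψ.mapAgent (abstr x̃) A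
  unpermute ρ {x̃} {A} {B} u e = begin
    B                                                    ≡⟨ mapAgent-flip (flip ρ) B ⟨
    Ψ.mapAgent right (Ψ.mapAgent left B)                 ≡⟨ cong (Ψ.mapAgent right) e ⟨
    Ψ.mapAgent right (Ψ.mapAgent (abstr (ρ · x̃)) A)
      ≡⟨ cong (Ψ.mapAgent right) (mapAgent-∘ (abstr-· ρ u) A) ⟨
    Ψ.mapAgent right (Ψ.mapAgent left (Ψ.mapAgent (abstr x̃) A))
      ≡⟨ mapAgent-flip (flip ρ) _ ⟩
    Ψ.mapAgent (abstr x̃) A                               ∎
    where
    open ≡-Reasoning
    left right : Fin _ ⊎ Name → Fin _ ⊎ Name
    left  = Sum.map₁ (ρ ⟨$⟩ˡ_)
    right = Sum.map₁ (ρ ⟨$⟩ʳ_)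

  bound∉ : ∀ {n} {A : Set} {is : Fin n → A} {v : V} → ¬ inj₂ v ∈ toList (tabulate (inj₁ ∘ is))
  bound∉ {n = suc n} (there m) = bound∉ m

  ext-· : ∀ {n} (ρ : Permutation′ n) (Δ : Vec Subject n) {srt : V → Subject} r →
          ext (ρ · Δ) srt (Sum.map₁ (ρ ⟨$⟩ˡ_) r) ≡ ext Δ srt r
  ext-· ρ Δ (inj₁ i) = lookup-·ˡ ρ Δ i
  ext-· ρ Δ (inj₂ v) = refl

  -- The encoding relation

  -- Whether a pi process is related only to its encoding, or to all agents that it decodes.
  data Flavour : Set where
    canonical liberal : Flavour

  -- The permutations by which the pattern of an input may differ from its binder: only the
  -- identity in the canonical case.
  data Admissible : ∀ {n} → Flavour → Permutation′ n → Set where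
    identity : ∀ {n m} → Admissible {n} m Perm.id
    any      : ∀ {n} {ρ : Permutation′ n} → Admissible liberal ρ

  -- Processes without transitions under every renaming: in νx [x = v]𝟎 the name v lies
  -- outside the scope of x, so no renaming identifies it with x.
  data Inert {V : Set} : Pi V → Set where
    nil   : Inert 𝟎
    stuck : ∀ {s v} → Inert (ν′ s (match (inj₁ zero) (inj₂ v) 𝟎))
    _⊕_   : ∀ {P Q} → Inert P → Inert Q → Inert (P ⊕ Q)

  -- The same free names.
  SameNames : Pi V → Pi V → Set
  SameNames P Q = ∀ v → (v Π.∈fn P → v Π.∈fn Q) × (v Π.∈fn Q → v Π.∈fn P)

  -- Enc m srt P A: the agent A encodes the pi process P.  Guardedness is recorded where a
  -- well-formed agent must be guarded.  In e-input, Δ lists the sorts of the pi binder and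
  -- Δ′ those of the psi binder, which is the pi binder permuted by ρ; B is the psi body with
  -- its bound positions in the order of the pi binder.  The last three constructors decode
  -- the first branch of a case; in e-⊥ the process P, which decodes the dead branch, serves
  -- only to make A well-formed and to give the free names of the inert process D.
  data Enc {V : Set} : Flavour → (V → Subject) → Pi V → Agent V → Set where
    e-nil    : ∀ {m srt} → Enc m srt 𝟎 (case [])
    e-input  : ∀ {m srt n x} {Δ Δ′ : Vec Subject n} {X P A B} (ρ : Permutation′ n) →
               Admissible m ρ → ob (srt x) ≡ just (toList Δ) →
               Δ′ ≡ ρ · Δ → X ≡ permutedPattern ρ → A ≡ Ψ.mapAgent (Sum.map₁ (ρ ⟨$⟩ˡ_)) B →
               Enc m (ext Δ srt) P B →
               Enc m srt (input′ x Δ P) (input′ (name x) Δ′ X A)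
    e-output : ∀ {m srt x ỹ P A} → ob (srt x) ≡ just (List.map srt ỹ) → Enc m srt P A →
               Enc m srt (output x ỹ P) (output (name x) ⟨ ỹ ⟩ A)
    e-match  : ∀ {m srt a b P A} → Guarded A → Enc m srt P A →
               Enc m srt (match a b P) (case ((a ≐ b , A) ∷ []))
    e-ν      : ∀ {m srt s P A} → Enc m (ext (s ∷ []) srt) P A → Enc m srt (ν′ s P) (ν′ s A)
    e-rep    : ∀ {m srt P A} → Guarded A → Enc m srt P A → Enc m srt (! P) (! A)
    e-par    : ∀ {m srt P Q A B} → Enc m srt P A → Enc m srt Q B → Enc m srt (P ∣ Q) (A ∣ B)
    e-sum    : ∀ {m srt P Q A B} → Guarded A → Guarded B → Enc m srt P A → Enc m srt Q B →
               Enc m srt (P ⊕ Q) (case ((⊤ᶜ , A) ∷ (⊤ᶜ , B) ∷ []))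
    e-assert : ∀ {srt Ψ} → Enc liberal srt 𝟎 ⦅ Ψ ⦆
    e-⊤      : ∀ {srt P Q A bs} → Guarded A → Enc liberal srt P A →
               Enc liberal srt Q (case bs) → Enc liberal srt (P ⊕ Q) (case ((⊤ᶜ , A) ∷ bs))
    e-⊥      : ∀ {srt P D Q A bs} → Guarded A → Enc liberal srt P A → Inert D → SameNames D P →
               Enc liberal srt Q (case bs) → Enc liberal srt (D ⊕ Q) (case ((⊥ᶜ , A) ∷ bs))
    e-≐      : ∀ {srt P Q A a b bs} → Guarded A → Enc liberal srt P A →
               Enc liberal srt Q (case bs) →
               Enc liberal srt (match a b P ⊕ Q) (case ((a ≐ b , A) ∷ bs))

  private variable
    m : Flavour
    srt : V → Subject
    P P′ Q D : Pi V
    A A′ B : Agent V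

  Inert-WellSorted : Inert D → WellSorted srt D
  Inert-WellSorted nil     = ws-𝟎
  Inert-WellSorted stuck   = ws-ν (ws-match ws-𝟎)
  Inert-WellSorted (i ⊕ j) = ws-sum (Inert-WellSorted i) (Inert-WellSorted j)

  Enc-WellSorted : Enc m srt P A → WellSorted srt P
  Enc-WellSorted e-nil                   = ws-𝟎
  Enc-WellSorted (e-input _ _ o _ _ _ e) = ws-input o (Enc-WellSorted e)
  Enc-WellSorted (e-output o e)          = ws-output o (Enc-WellSorted e)
  Enc-WellSorted (e-match _ e)           = ws-match (Enc-WellSorted e)
  Enc-WellSorted (e-ν e)                 = ws-ν (Enc-WellSorted e)
  Enc-WellSorted (e-rep _ e)             = ws-rep (Enc-WellSorted e)
  Enc-WellSorted (e-par e f)             = ws-par (Enc-WellSorted e) (Enc-WellSorted f)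
  Enc-WellSorted (e-sum _ _ e f)         = ws-sum (Enc-WellSorted e) (Enc-WellSorted f)
  Enc-WellSorted e-assert                = ws-𝟎
  Enc-WellSorted (e-⊤ _ e f)             = ws-sum (Enc-WellSorted e) (Enc-WellSorted f)
  Enc-WellSorted (e-⊥ _ _ i _ f)         = ws-sum (Inert-WellSorted i) (Enc-WellSorted f)
  Enc-WellSorted (e-≐ _ e f)             = ws-sum (ws-match (Enc-WellSorted e)) (Enc-WellSorted f)

  branches : ∀ {bs} → WF srt (case bs) → All (λ b → WF srt (proj₂ b) × Guarded (proj₂ b)) bs
  branches (wf-case ws) = ws

  Enc-WF : Enc m srt P A → WF srt A
  Enc-WF e-nil = wf-case []
  Enc-WF {srt = srt} (e-input {Δ = Δ} ρ _ o refl refl refl e) =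
    wf-input (Ψ.carries (trans o (cong just (sym (pattern-sorts ρ Δ srt)))))
      ( List.tabulate (ρ ⟨$⟩ˡ_)
      , trans (toList-tabulate _) (sym (List.map-tabulate (ρ ⟨$⟩ˡ_) inj₁))
      , ListUnique.tabulate⁺ (λ {i} {j} h →
          trans (sym (inverseʳ ρ)) (trans (cong (ρ ⟨$⟩ʳ_) h) (inverseʳ ρ)))
      , λ i → subst (_∈ _) (inverseˡ ρ) (∈-tabulate⁺ (ρ ⟨$⟩ʳ i)))
      (Ψ.mapAgent-WF _ (ext-· ρ Δ) (Enc-WF e))
  Enc-WF (e-output o e)    = wf-output (Ψ.carries o) (Enc-WF e)
  Enc-WF (e-match g e)     = wf-case ((Enc-WF e , g) ∷ [])
  Enc-WF (e-ν e)           = wf-ν (Enc-WF e)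
  Enc-WF (e-rep g e)       = wf-rep (Enc-WF e) g
  Enc-WF (e-par e f)       = wf-par (Enc-WF e) (Enc-WF f)
  Enc-WF (e-sum g h e f)   = wf-case ((Enc-WF e , g) ∷ (Enc-WF f , h) ∷ [])
  Enc-WF e-assert          = wf-assert
  Enc-WF (e-⊤ g e f)       = wf-case ((Enc-WF e , g) ∷ branches (Enc-WF f))
  Enc-WF (e-⊥ g e _ _ f)   = wf-case ((Enc-WF e , g) ∷ branches (Enc-WF f))
  Enc-WF (e-≐ g e f)       = wf-case ((Enc-WF e , g) ∷ branches (Enc-WF f))

  -- Related processes and agents have the same free names.
  Enc-fn⁺ : Enc m srt P A → ∀ {v} → v Π.∈fn P → v Ψ.∈fn A
  Enc-fn⁺ (e-input _ _ _ _ _ _ e)    (inj₁ refl) = inj₁ (here refl)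
  Enc-fn⁺ (e-input {B = B} ρ _ _ _ _ refl e) (inj₂ p) =
    inj₂ (inj₂ (mapAgent-fn⁺ (Sum.map₁ (ρ ⟨$⟩ˡ_)) B (Enc-fn⁺ e p)))
  Enc-fn⁺ (e-output _ e) (inj₁ refl)     = inj₁ (here refl)
  Enc-fn⁺ (e-output _ e) (inj₂ p)        = inj₂ (Sum.map₂ (Enc-fn⁺ e) p)
  Enc-fn⁺ (e-match _ e) (inj₁ refl)        = inj₁ (here refl)
  Enc-fn⁺ (e-match _ e) (inj₂ (inj₁ refl)) = inj₁ (there (here refl))
  Enc-fn⁺ (e-match _ e) (inj₂ (inj₂ p))    = inj₂ (inj₁ (Enc-fn⁺ e p))
  Enc-fn⁺ (e-ν e)         p = Enc-fn⁺ e p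
  Enc-fn⁺ (e-rep _ e)     p = Enc-fn⁺ e p
  Enc-fn⁺ (e-par e f)     p = Sum.map (Enc-fn⁺ e) (Enc-fn⁺ f) p
  Enc-fn⁺ (e-sum _ _ e f) (inj₁ p) = inj₂ (inj₁ (Enc-fn⁺ e p))
  Enc-fn⁺ (e-sum _ _ e f) (inj₂ p) = inj₂ (inj₂ (inj₂ (inj₁ (Enc-fn⁺ f p))))
  Enc-fn⁺ (e-⊤ _ e f)     p        = inj₂ (Sum.map (Enc-fn⁺ e) (Enc-fn⁺ f) p)
  Enc-fn⁺ (e-⊥ _ e _ s f) p        =
    inj₂ (Sum.map (λ q → Enc-fn⁺ e (proj₁ (s _) q)) (Enc-fn⁺ f) p)
  Enc-fn⁺ (e-≐ _ e f) (inj₁ (inj₁ refl))        = inj₁ (here refl)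
  Enc-fn⁺ (e-≐ _ e f) (inj₁ (inj₂ (inj₁ refl))) = inj₁ (there (here refl))
  Enc-fn⁺ (e-≐ _ e f) (inj₁ (inj₂ (inj₂ p)))    = inj₂ (inj₁ (Enc-fn⁺ e p))
  Enc-fn⁺ (e-≐ _ e f) (inj₂ p)                  = inj₂ (inj₂ (Enc-fn⁺ f p))

  Enc-fn⁻ : Enc m srt P A → ∀ {v} → v Ψ.∈fn A → v Π.∈fn P
  Enc-fn⁻ (e-input _ _ _ _ _ _ e)    (inj₁ (here refl)) = inj₁ refl
  Enc-fn⁻ (e-input _ _ _ _ refl _ e) (inj₂ (inj₁ p))    = contradiction p bound∉
  Enc-fn⁻ (e-input {B = B} _ _ _ _ _ refl e) (inj₂ (inj₂ p)) with mapAgent-fn⁻ B p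
  ... | inj₂ v , q , refl = inj₂ (Enc-fn⁻ e q)
  Enc-fn⁻ (e-output _ e) (inj₁ (here refl)) = inj₁ refl
  Enc-fn⁻ (e-output _ e) (inj₂ p)           = inj₂ (Sum.map₂ (Enc-fn⁻ e) p)
  Enc-fn⁻ (e-match _ e) (inj₁ (here refl))         = inj₁ refl
  Enc-fn⁻ (e-match _ e) (inj₁ (there (here refl))) = inj₂ (inj₁ refl)
  Enc-fn⁻ (e-match _ e) (inj₂ (inj₁ p))            = inj₂ (inj₂ (Enc-fn⁻ e p))
  Enc-fn⁻ (e-ν e)         p = Enc-fn⁻ e p
  Enc-fn⁻ (e-rep _ e)     p = Enc-fn⁻ e p
  Enc-fn⁻ (e-par e f)     p = Sum.map (Enc-fn⁻ e) (Enc-fn⁻ f) p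
  Enc-fn⁻ (e-sum _ _ e f) (inj₂ (inj₁ p))               = inj₁ (Enc-fn⁻ e p)
  Enc-fn⁻ (e-sum _ _ e f) (inj₂ (inj₂ (inj₂ (inj₁ p)))) = inj₂ (Enc-fn⁻ f p)
  Enc-fn⁻ (e-⊤ _ e f)     (inj₂ p) = Sum.map (Enc-fn⁻ e) (Enc-fn⁻ f) p
  Enc-fn⁻ (e-⊥ _ e _ s f) (inj₂ p) = Sum.map (λ q → proj₂ (s _) (Enc-fn⁻ e q)) (Enc-fn⁻ f) p
  Enc-fn⁻ (e-≐ _ e f) (inj₁ (here refl))         = inj₁ (inj₁ refl)
  Enc-fn⁻ (e-≐ _ e f) (inj₁ (there (here refl))) = inj₁ (inj₂ (inj₁ refl))
  Enc-fn⁻ (e-≐ _ e f) (inj₂ (inj₁ p))            = inj₁ (inj₂ (inj₂ (Enc-fn⁻ e p)))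
  Enc-fn⁻ (e-≐ _ e f) (inj₂ (inj₂ p))            = inj₂ (Enc-fn⁻ f p)

  Inert-map : (f : V → W) → Inert D → Inert (Π.mapPi f D)
  Inert-map f nil     = nil
  Inert-map f stuck   = stuck
  Inert-map f (i ⊕ j) = Inert-map f i ⊕ Inert-map f j

  SameNames-map : (f : V → W) → SameNames P Q → SameNames (Π.mapPi f P) (Π.mapPi f Q)
  SameNames-map {P = P} {Q = Q} f s w = to , from
    where
    to : w Π.∈fn Π.mapPi f P → w Π.∈fn Π.mapPi f Q
    to p with mapPi-fn⁻ P p
    ... | v , q , refl = mapPi-fn⁺ f Q (proj₁ (s v) q)
    from : w Π.∈fn Π.mapPi f Q → w Π.∈fn Π.mapPi f P
    from p with mapPi-fn⁻ Q p
    ... | v , q , refl = mapPi-fn⁺ f P (proj₂ (s v) q)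

  map₁₂-comm : ∀ {A B : Set} {f : V → W} {g : A → B} (r : A ⊎ V) →
               Sum.map₂ f (Sum.map₁ g r) ≡ Sum.map g f r
  map₁₂-comm (inj₁ i) = refl
  map₁₂-comm (inj₂ v) = refl

  map₂₁-comm : ∀ {A B : Set} {f : V → W} {g : A → B} (r : A ⊎ V) →
               Sum.map₁ g (Sum.map₂ f r) ≡ Sum.map g f r
  map₂₁-comm (inj₁ i) = refl
  map₂₁-comm (inj₂ v) = refl

  Enc-map : {srtV : V → Subject} {srtW : W → Subject} (f : V → W) →
            (∀ v → srtW (f v) ≡ srtV v) →
            Enc m srtV P A → Enc m srtW (Π.mapPi f P) (Ψ.mapAgent f A)
  Enc-map f h e-nil = e-nil
  Enc-map f h (e-input {x = x} {Δ} {B = B} ρ adm o refl refl refl e) =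
    e-input ρ adm (trans (cong ob (h x)) o) refl (map-pattern ρ (Sum.map₂ f))
      (trans (mapAgent-∘ map₁₂-comm B) (sym (mapAgent-∘ map₂₁-comm B)))
      (Enc-map (Sum.map₂ f) (ext-map Δ f h) e)
  Enc-map f h (e-output {x = x} {ỹ} o e) = e-output (Π.map-ob f h x ỹ o) (Enc-map f h e)
  Enc-map f h (e-match g e)     = e-match (Ψ.mapAgent-Guarded f g) (Enc-map f h e)
  Enc-map f h (e-ν e)           = e-ν (Enc-map (Sum.map₂ f) (ext-map (_ ∷ []) f h) e)
  Enc-map f h (e-rep g e)       = e-rep (Ψ.mapAgent-Guarded f g) (Enc-map f h e)
  Enc-map f h (e-par e e′)      = e-par (Enc-map f h e) (Enc-map f h e′)
  Enc-map f h (e-sum g g′ e e′) =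
    e-sum (Ψ.mapAgent-Guarded f g) (Ψ.mapAgent-Guarded f g′) (Enc-map f h e) (Enc-map f h e′)
  Enc-map f h e-assert          = e-assert
  Enc-map f h (e-⊤ g e e′)      = e-⊤ (Ψ.mapAgent-Guarded f g) (Enc-map f h e) (Enc-map f h e′)
  Enc-map f h (e-⊥ {P = P} {D} g e i s e′)  =
    e-⊥ (Ψ.mapAgent-Guarded f g) (Enc-map f h e) (Inert-map f i)
        (SameNames-map {P = D} {Q = P} f s) (Enc-map f h e′)
  Enc-map f h (e-≐ g e e′)      = e-≐ (Ψ.mapAgent-Guarded f g) (Enc-map f h e) (Enc-map f h e′)

  -- If the process is an image under a renaming f with a left inverse g, then so is the
  -- agent: f after g fixes the free names of the process, which are those of the agent.
  Enc-unmap-agent : {srtV : V → Subject} {srtW : W → Subject} (f : V → W) (g : W → V) →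
                    (∀ v → g (f v) ≡ v) → (∀ w → srtV (g w) ≡ srtW w) → ∀ P →
                    Enc m srtW (Π.mapPi f P) A →
                    Σ[ B ∈ Agent V ] A ≡ Ψ.mapAgent f B × Enc m srtV P B
  Enc-unmap-agent {m = m} {A = A} {srtV} f g gf h P e =
    Ψ.mapAgent g A
    , sym (trans (mapAgent-∘ (λ _ → refl) A) (mapAgent-fixed A fixed))
    , subst (λ P → Enc m srtV P (Ψ.mapAgent g A))
            (trans (mapPi-∘ gf P) (mapPi-fixed {f = id} P (λ _ → refl))) (Enc-map g h e)
    where
    fixed : ∀ {w} → w Ψ.∈fn A → f (g w) ≡ w
    fixed q with mapPi-fn⁻ P (Enc-fn⁻ e q)
    ... | v , _ , refl = cong f (gf v)

  Enc-unmap-process : {srtV : V → Subject} {srtW : W → Subject} (f : V → W) (g : W → V) →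
                      (∀ v → g (f v) ≡ v) → (∀ w → srtV (g w) ≡ srtW w) → ∀ A →
                      Enc m srtW P (Ψ.mapAgent f A) →
                      Σ[ Q ∈ Pi V ] P ≡ Π.mapPi f Q × Enc m srtV Q A
  Enc-unmap-process {m = m} {P = P} {srtV} f g gf h A e =
    Π.mapPi g P
    , sym (trans (mapPi-∘ (λ _ → refl) P) (mapPi-fixed P fixed))
    , subst (Enc m srtV (Π.mapPi g P))
            (trans (mapAgent-∘ gf A) (mapAgent-fixed {f = id} A (λ _ → refl))) (Enc-map g h e)
    where
    fixed : ∀ {w} → w Π.∈fn P → f (g w) ≡ w
    fixed q with mapAgent-fn⁻ A (Enc-fn⁺ e q)
    ... | v , _ , refl = cong f (gf v)

  unabstr-agent : ∀ {n} {A : Agent (Fin n ⊎ Name)} (x̃ : Vec Name n) P →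
                  Enc m (ext (Vec.map sort x̃) sort) (Π.mapPi (abstr x̃) P) A →
                  Σ[ B ∈ Agent Name ] A ≡ Ψ.mapAgent (abstr x̃) B × Enc m sort P B
  unabstr-agent x̃ = Enc-unmap-agent (abstr x̃) (inst x̃) (inst-abstr x̃) (inst-sort x̃)

  unabstr-process : ∀ {n} {P : Pi (Fin n ⊎ Name)} (x̃ : Vec Name n) A →
                    Enc m (ext (Vec.map sort x̃) sort) P (Ψ.mapAgent (abstr x̃) A) →
                    Σ[ Q ∈ Pi Name ] P ≡ Π.mapPi (abstr x̃) Q × Enc m sort Q A
  unabstr-process x̃ = Enc-unmap-process (abstr x̃) (inst x̃) (inst-abstr x̃) (inst-sort x̃)

  -- Operational correspondence

  -- The psi action of a pi action.
  ⌈_⌉ : Π.Act → Ψ.Act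
  ⌈ Π.out x̃ z ỹ ⌉ = Ψ.out (name z) x̃ ⟨ ỹ ⟩
  ⌈ Π.inp x z̃ ⌉   = Ψ.inp (name x) ⟨ z̃ ⟩
  ⌈ Π.τ ⌉         = Ψ.τ

  bn-⌈⌉ : ∀ β → Ψ.bn ⌈ β ⌉ ≡ Π.bn β
  bn-⌈⌉ (Π.out x̃ z ỹ) = refl
  bn-⌈⌉ (Π.inp x z̃)   = refl
  bn-⌈⌉ Π.τ           = refl

  actNames-⌈⌉ : ∀ β → Ψ.actNames ⌈ β ⌉ ↭ Π.actNames β
  actNames-⌈⌉ (Π.out x̃ z ỹ) = ↭-sym (shift z x̃ ỹ)
  actNames-⌈⌉ (Π.inp x z̃)   = ↭-refl
  actNames-⌈⌉ Π.τ           = ↭-refl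

  ν-Enc : ∀ a {P A} → Enc m sort P A → Enc m sort (Π.ν a P) (Ψ.ν a A)
  ν-Enc a e = e-ν (Enc-map (abstr (a ∷ [])) (abstr-sort (a ∷ [])) e)

  ν*-Enc : ∀ ã {P A} → Enc m sort P A → Enc m sort (Π.ν* ã P) (Ψ.ν* ã A)
  ν*-Enc []      e = e
  ν*-Enc (a ∷ ã) e = ν-Enc a (ν*-Enc ã e)

  swap-Enc : ∀ {a b P A} → sort a ≡ sort b → Enc m sort P A →
             Enc m sort (Π.mapPi (swapName a b) P) (Ψ.mapAgent (swapName a b) A)
  swap-Enc s = Enc-map _ (act-sort (swapping _ _ s))

  match-≡ : ∀ {a b P P′ β} → match a b P Π.-[ β ]→ P′ → a ≡ b
  match-≡ (Π.MATCH _)           = refl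
  match-≡ (Π.PERM d _)          = match-≡ d
  match-≡ (Π.ALPHA d _ _ _ _ _) = match-≡ d

  ν-stuck : ∀ x P {P′ β} → Inert (Π.ν x P) → ¬ P Π.-[ β ]→ P′
  -- If Π.ν x P is inert then P is a match between its bound name and another one.
  ν-stuck x P i d with Π.mapPi (abstr (x ∷ [])) P in eq
  ν-stuck x (match a b _) stuck d | _ with match-≡ d
  ... | refl with abstr (x ∷ []) a
  ν-stuck x (match a b _) stuck d | _ | refl | inj₁ _ with () ← eq
  ν-stuck x (match a b _) stuck d | _ | refl | inj₂ _ with () ← eq
  ν-stuck x 𝟎 stuck d | _ with () ← eq

  Inert-deadlocked : ∀ {P P′ β} → Inert P → ¬ P Π.-[ β ]→ P′
  Inert-deadlocked i       (Π.PERM d _)          = Inert-deadlocked i d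
  Inert-deadlocked i       (Π.ALPHA d _ _ _ _ _) = Inert-deadlocked i d
  Inert-deadlocked (i ⊕ j) (Π.SUMˡ d)            = Inert-deadlocked i d
  Inert-deadlocked (i ⊕ j) (Π.SUMʳ d)            = Inert-deadlocked j d
  Inert-deadlocked i       (Π.RES {x = x} {P = P} d _)      = ν-stuck x P i d
  Inert-deadlocked i       (Π.OPEN {x = x} {P = P} d _ _ _) = ν-stuck x P i d

  -- The order of the bound names of an output action is immaterial: at OPEN, the opened name
  -- is found again in the permuted list and inserted there.
  PERM-admissible : ∀ {A A′ M N ã b̃} →
                    A Ψ.-[ Ψ.out M ã N ]→ A′ → ã ↭ b̃ → A Ψ.-[ Ψ.out M b̃ N ]→ A′
  PERM-admissible {b̃ = b̃} (Ψ.OUT e) p with refl ← ↭-empty-inv (↭-sym p) = Ψ.OUT e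
  PERM-admissible (Ψ.PARˡ d f) p = Ψ.PARˡ (PERM-admissible d p) (All-resp-↭ p f)
  PERM-admissible (Ψ.PARʳ d f) p = Ψ.PARʳ (PERM-admissible d p) (All-resp-↭ p f)
  PERM-admissible (Ψ.CASE i d e) p = Ψ.CASE i (PERM-admissible d p) e
  PERM-admissible (Ψ.REP d) p = Ψ.REP (PERM-admissible d p)
  PERM-admissible {M = M} {N} (Ψ.SCOPE d f) p =
    Ψ.SCOPE (PERM-admissible d p)
      (f ∘ ∈-resp-↭ (↭.++⁺ˡ (Ψ.names M) (↭.++⁺ʳ (Ψ.names N) (↭-sym p))))
  PERM-admissible (Ψ.OPEN ã₁ ã₂ d b∉ã b∉M b∈N) p with ∈-∃++ (∈-resp-↭ p (∈-insert ã₁))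
  ... | b̃₁ , b̃₂ , refl =
    Ψ.OPEN b̃₁ b̃₂ (PERM-admissible d q) (b∉ã ∘ ∈-resp-↭ (↭-sym q)) b∉M b∈N
    where q = drop-mid ã₁ b̃₁ p
  -- The swapping is an involution, so it carries the permutation back to the premise.
  PERM-admissible {b̃ = b̃} (Ψ.ALPHA {ã = ã} {a = a} {b} d a∈ã s b∉M b∉N b#) p =
    subst (λ c̃ → _ Ψ.-[ Ψ.out _ c̃ _ ]→ _) (unswap b̃)
      (Ψ.ALPHA (PERM-admissible d q) (∈-resp-↭ q a∈ã) s b∉M b∉N b#)
    where
    π : Swapping
    π = swapping a b s
    unswap : ∀ c̃ → List.map (act π) (List.map (act π) c̃) ≡ c̃
    unswap c̃ = trans (map-agree (act-involutive π) c̃) (List.map-id c̃)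
    q : ã ↭ List.map (act π) b̃
    q = subst (_↭ List.map (act π) b̃) (unswap ã) (↭.map⁺ (act π) p)

  case-⊆ : ∀ {bs cs α A′} → bs ⊆ cs → case bs Ψ.-[ α ]→ A′ → case cs Ψ.-[ α ]→ A′
  case-⊆ s (Ψ.CASE i d e)          = Ψ.CASE (s i) d e
  case-⊆ s (Ψ.ALPHA d a∈ e i j b#) = Ψ.ALPHA (case-⊆ s d) a∈ e i j b#

  -- A ⇒[ β ] (m , P′): A has the transition ⌈ β ⌉ to an agent which encodes P′.
  infix 4 _⇒[_]_

  _⇒[_]_ : Agent Name → Π.Act → (Flavour × Pi Name) → Set
  A ⇒[ β ] (m , P′) = Σ[ A′ ∈ Agent Name ] A Ψ.-[ ⌈ β ⌉ ]→ A′ × Enc m sort P′ A′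

  -- With x̃ the names bound by the process, the agent is an input binding ρ · x̃ whose pattern
  -- is ⟨x̃⟩, so matching gives it the values ρ · z̃.
  forward-IN : ∀ {n x P A} {x̃ z̃ : Vec Name n} → Enc m sort (Π.input x x̃ P) A → Unique x̃ →
               Vec.map sort z̃ ≡ Vec.map sort x̃ →
               A ⇒[ Π.inp x (toList z̃) ] (m , Π.mapPi (x̃ := z̃) P)
  forward-IN {x = x} {P = P} {x̃ = x̃} {z̃} (e-input ρ _ _ refl refl refl e) u s
    with unabstr-agent x̃ P e
  ... | A , refl , e′ =
    Ψ.mapAgent (x̃ := z̃) A
    , subst₂ (λ B A′ → B Ψ.-[ Ψ.inp (name x) ⟨ toList z̃ ⟩ ]→ A′) source
        (mapAgent-cong (:=-· ρ z̃ u) A)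
        (Ψ.IN {X = toList x̃} (Unique-· ρ u) ⊢≐ (z̃ , x̃ , ρ , refl , refl , s , refl , refl))
    , Enc-map (x̃ := z̃) (:=-sort x̃ z̃ (sym s)) e′
    where
    source : Ψ.input (name _) (ρ · x̃) (toList x̃) A ≡
             input′ (name _) (ρ · Vec.map sort x̃) (permutedPattern ρ)
                    (Ψ.mapAgent (Sum.map₁ (ρ ⟨$⟩ˡ_)) (Ψ.mapAgent (abstr x̃) A))
    source = cong₃ (input′ (name _)) (map-· sort ρ x̃) (abstr-pattern ρ u)
                   (sym (mapAgent-∘ (abstr-· ρ u) A))

  forward : ∀ {P P′ A β} → P Π.-[ β ]→ P′ → Enc m sort P A → A ⇒[ β ] (m , P′)
  forward Π.OUT (e-output _ e) = _ , Ψ.OUT ⊢≐ , e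
  forward (Π.IN u s) e = forward-IN e u s
  forward (Π.SUMˡ d) (e-sum _ _ e _) with forward d e
  ... | _ , d′ , e′ = _ , Ψ.CASE (here refl) d′ ⊢⊤ , e′
  forward (Π.SUMˡ d) (e-⊤ _ e _) with forward d e
  ... | _ , d′ , e′ = _ , Ψ.CASE (here refl) d′ ⊢⊤ , e′
  forward (Π.SUMˡ d) (e-⊥ _ _ i _ _) = contradiction d (Inert-deadlocked i)
  -- The branch by itself, as a case of its own, encodes the match.
  forward (Π.SUMˡ d) (e-≐ g e _) with forward d (e-match g e)
  ... | _ , d′ , e′ = _ , case-⊆ (λ { (here p) → here p }) d′ , e′
  forward (Π.SUMʳ d) (e-sum _ _ _ e) with forward d e
  ... | _ , d′ , e′ = _ , Ψ.CASE (there (here refl)) d′ ⊢⊤ , e′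
  forward (Π.SUMʳ d) (e-⊤ _ _ e) with forward d e
  ... | _ , d′ , e′ = _ , case-⊆ there d′ , e′
  forward (Π.SUMʳ d) (e-⊥ _ _ _ _ e) with forward d e
  ... | _ , d′ , e′ = _ , case-⊆ there d′ , e′
  forward (Π.SUMʳ d) (e-≐ _ _ e) with forward d e
  ... | _ , d′ , e′ = _ , case-⊆ there d′ , e′
  forward (Π.MATCH d) (e-match _ e) with forward d e
  ... | _ , d′ , e′ = _ , Ψ.CASE (here refl) d′ ⊢≐ , e′
  forward {β = β} (Π.PARˡ d f) (e-par e₁ e₂) with forward d e₁
  ... | _ , d′ , e′ =
    _ , Ψ.PARˡ d′ (subst (All _) (sym (bn-⌈⌉ β)) (All.map (_∘ Enc-fn⁻ e₂) f)) , e-par e′ e₂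
  forward {β = β} (Π.PARʳ d f) (e-par e₁ e₂) with forward d e₂
  ... | _ , d′ , e′ =
    _ , Ψ.PARʳ d′ (subst (All _) (sym (bn-⌈⌉ β)) (All.map (_∘ Enc-fn⁻ e₁) f)) , e-par e₁ e′
  forward {β = β} (Π.RES {x = x} {P} d f) (e-ν e) with unabstr-agent (x ∷ []) P e
  ... | _ , refl , e₁ with forward d e₁
  ...   | _ , d′ , e′ = _ , Ψ.SCOPE d′ (f ∘ ∈-resp-↭ (actNames-⌈⌉ β)) , ν-Enc x e′
  forward (Π.REP d) (e-rep g e) with forward d (e-par e (e-rep g e))
  ... | _ , d′ , e′ = _ , Ψ.REP d′ , e′
  forward (Π.COMˡ {x̃ = x̃} d₁ d₂ f) (e-par e₁ e₂) with forward d₁ e₁ | forward d₂ e₂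
  ... | _ , d₁′ , e₁′ | _ , d₂′ , e₂′ =
    _ , Ψ.COMˡ d₁′ d₂′ ⊢≐ (All.map (_∘ Enc-fn⁻ e₂) f) , ν*-Enc x̃ (e-par e₁′ e₂′)
  forward (Π.COMʳ {x̃ = x̃} d₁ d₂ f) (e-par e₁ e₂) with forward d₁ e₁ | forward d₂ e₂
  ... | _ , d₁′ , e₁′ | _ , d₂′ , e₂′ =
    _ , Ψ.COMʳ d₁′ d₂′ ⊢≐ (All.map (_∘ Enc-fn⁻ e₁) f) , ν*-Enc x̃ (e-par e₁′ e₂′)
  forward (Π.OPEN {x = x} {P} {x̃ = x̃} d x≢z x∈ỹ x∉x̃) (e-ν e) with unabstr-agent (x ∷ []) P e
  ... | _ , refl , e₁ with forward d e₁
  ...   | _ , d′ , e′ = _ , Ψ.OPEN [] x̃ d′ x∉x̃ (λ { (here p) → x≢z p }) x∈ỹ , e′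
  forward (Π.PERM d p) e with forward d e
  ... | _ , d′ , e′ = _ , PERM-admissible d′ p , e′
  forward (Π.ALPHA d a∈ s b≢z b∉ỹ b#) e with forward d e
  ... | _ , d′ , e′ =
    _ , Ψ.ALPHA d′ a∈ s (λ { (here p) → b≢z p }) b∉ỹ (b# ∘ Enc-fn⁻ e′) , swap-Enc s e′

  -- P ⇐[ α ] (m , A′): α is the image of an action with which P goes to a process that A′
  -- encodes.
  infix 4 _⇐[_]_

  _⇐[_]_ : Pi Name → Ψ.Act → (Flavour × Agent Name) → Set
  P ⇐[ α ] (m , A′) =
    Σ[ β ∈ Π.Act ] Σ[ P′ ∈ Pi Name ] α ≡ ⌈ β ⌉ × P Π.-[ β ]→ P′ × Enc m sort P′ A′

  backward-IN : ∀ {n M K N X A P} {x̃ L̃ : Vec Name n} → Enc m sort P (Ψ.input M x̃ X A) →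
                Unique x̃ → 𝟏 ⊢ M Ψ.↔ᶜ K → Ψ.Match N x̃ X L̃ →
                P ⇐[ Ψ.inp K N ] (m , Ψ.mapAgent (x̃ := L̃) A)
  backward-IN {m = m} {K = name x} {A = A} {x̃ = x̃} (e-input {Δ = Δ} ρ _ _ Δ≡ X≡ A≡ e) u ⊢≐
              (z̃ , ỹ , π , refl , refl , s , x̃≡ , refl)
    with abstr-pattern⁻ ρ {x̃} {ỹ} X≡
  ... | refl with ·-injective ρ {Δ} {Vec.map sort ỹ} (trans (sym Δ≡) (map-· sort ρ ỹ))
                | Unique-·⁻ ρ {ỹ} u
  ...   | refl | u′ with unabstr-process ỹ A (subst (Enc m _ _) (unpermute ρ u′ A≡) e)
  ...     | Q , refl , e′ =
    Π.inp x (toList z̃) , _ , refl , Π.IN u′ s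
    , subst (Enc m sort _) derivative (Enc-map (ỹ := z̃) (:=-sort ỹ z̃ (sym s)) e′)
    where
    derivative : Ψ.mapAgent (ỹ := z̃) A ≡ Ψ.mapAgent (ρ · ỹ := π · z̃) A
    derivative = trans (sym (mapAgent-cong (:=-· ρ z̃ u′) A))
      (cong (λ L̃ → Ψ.mapAgent (ρ · ỹ := L̃) A) (·-agree {π = ρ} {π} u′ x̃≡ z̃))

  backward-OUT : ∀ {M K N A P} → Enc m sort P (output M N A) → 𝟏 ⊢ M Ψ.↔ᶜ K →
                 P ⇐[ Ψ.out K [] N ] (m , A)
  backward-OUT {K = name _} (e-output _ e) ⊢≐ = Π.out _ _ _ , _ , refl , Π.OUT , e

  backward-OPEN : ∀ {P Q A′ M N b} ã₁ ã₂ → P ⇐[ Ψ.out M (ã₁ ++ ã₂) N ] (m , A′) →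
                  b ∉ ã₁ ++ ã₂ → b ∉ Ψ.names M → b ∈ Ψ.names N →
                  Q ≡ Π.mapPi (abstr (b ∷ [])) P →
                  ν′ (sort b) Q ⇐[ Ψ.out M (ã₁ ++ b ∷ ã₂) N ] (m , A′)
  backward-OPEN {b = b} ã₁ ã₂ (Π.out _ z ỹ , _ , refl , d , e) b∉ã b∉M b∈N refl =
    Π.out _ z ỹ , _ , refl
    , Π.PERM (Π.OPEN d (b∉M ∘ here) b∈N b∉ã) (↭-sym (shift b ã₁ ã₂)) , e

  backward-ALPHA : ∀ {P A′ M ã N a b} → P ⇐[ Ψ.out M ã N ] (m , A′) →
                   a ∈ ã → sort a ≡ sort b → b ∉ Ψ.names M → b ∉ Ψ.names N → b Ψ.# A′ →
                   P ⇐[ Ψ.out M (List.map (swapName a b) ã) (Ψ.mapTerm (swapName a b) N) ]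
                     (m , Ψ.mapAgent (swapName a b) A′)
  backward-ALPHA (Π.out _ z ỹ , _ , refl , d , e) a∈ã s b∉M b∉N b#A′ =
    Π.out _ z _ , _ , refl
    , Π.ALPHA d a∈ã s (b∉M ∘ here) b∉N (b#A′ ∘ Enc-fn⁺ e) , swap-Enc s e

  -- Q acts like some process encoded by A.
  Branch : Flavour → Pi Name → Agent Name → Set
  Branch m Q A =
    Σ[ P ∈ Pi Name ] Enc m sort P A × (∀ {β P′} → P Π.-[ β ]→ P′ → Q Π.-[ β ]→ P′)

  branch : ∀ {Q bs φ A} → Enc m sort Q (case bs) → (φ , A) ∈ bs → 𝟏 ⊢ φ → Branch m Q A
  branch (e-match _ e)   (here refl) ⊢≐         = _ , e , Π.MATCH
  branch (e-sum _ _ e _) (here refl) _          = _ , e , Π.SUMˡ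
  branch (e-sum _ _ _ e) (there (here refl)) _  = _ , e , Π.SUMʳ
  branch (e-⊤ _ e _)     (here refl) _          = _ , e , Π.SUMˡ
  branch (e-≐ _ e _)     (here refl) ⊢≐         = _ , e , Π.SUMˡ ∘ Π.MATCH
  branch (e-⊥ _ _ _ _ _) (here refl) ()
  branch (e-⊤ _ _ e)     (there i) t with branch e i t
  ... | _ , e′ , step = _ , e′ , Π.SUMʳ ∘ step
  branch (e-⊥ _ _ _ _ e) (there i) t with branch e i t
  ... | _ , e′ , step = _ , e′ , Π.SUMʳ ∘ step
  branch (e-≐ _ _ e)     (there i) t with branch e i t
  ... | _ , e′ , step = _ , e′ , Π.SUMʳ ∘ step

  backward : ∀ {P A A′ α} → A Ψ.-[ α ]→ A′ → Enc m sort P A → P ⇐[ α ] (m , A′)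
  backward (Ψ.IN u M↔K i) e = backward-IN e u M↔K i
  backward (Ψ.OUT M↔K) e = backward-OUT e M↔K
  backward (Ψ.CASE i d t) e with branch e i t
  ... | _ , e₁ , step with backward d e₁
  ...   | β , _ , refl , d′ , e′ = β , _ , refl , step d′ , e′
  backward (Ψ.PARˡ d f) (e-par e₁ e₂) with backward d e₁
  ... | β , _ , refl , d′ , e′ =
    β , _ , refl , Π.PARˡ d′ (subst (All _) (bn-⌈⌉ β) (All.map (_∘ Enc-fn⁺ e₂) f)) , e-par e′ e₂
  backward (Ψ.PARʳ d f) (e-par e₁ e₂) with backward d e₂
  ... | β , _ , refl , d′ , e′ =
    β , _ , refl , Π.PARʳ d′ (subst (All _) (bn-⌈⌉ β) (All.map (_∘ Enc-fn⁺ e₁) f)) , e-par e₁ e′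
  backward (Ψ.SCOPE {b = b} {A} d f) (e-ν e) with unabstr-process (b ∷ []) A e
  ... | _ , refl , e₁ with backward d e₁
  ...   | β , _ , refl , d′ , e′ =
    β , _ , refl , Π.RES d′ (f ∘ ∈-resp-↭ (↭-sym (actNames-⌈⌉ β))) , ν-Enc b e′
  backward (Ψ.REP d) (e-rep g e) with backward d (e-par e (e-rep g e))
  ... | β , _ , refl , d′ , e′ = β , _ , refl , Π.REP d′ , e′
  backward (Ψ.COMˡ {ã = ã} d₁ d₂ M↔K f) (e-par e₁ e₂) with backward d₁ e₁ | backward d₂ e₂ | M↔K
  ... | Π.out _ _ _ , _ , refl , d₁′ , e₁′ | Π.inp _ _ , _ , refl , d₂′ , e₂′ | ⊢≐ =
    Π.τ , _ , refl , Π.COMˡ d₁′ d₂′ (All.map (_∘ Enc-fn⁺ e₂) f) , ν*-Enc ã (e-par e₁′ e₂′)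
  backward (Ψ.COMʳ {ã = ã} d₁ d₂ M↔K f) (e-par e₁ e₂) with backward d₁ e₁ | backward d₂ e₂ | M↔K
  ... | Π.inp _ _ , _ , refl , d₁′ , e₁′ | Π.out _ _ _ , _ , refl , d₂′ , e₂′ | ⊢≐ =
    Π.τ , _ , refl , Π.COMʳ d₁′ d₂′ (All.map (_∘ Enc-fn⁺ e₁) f) , ν*-Enc ã (e-par e₁′ e₂′)
  backward (Ψ.OPEN {b = b} {A} ã₁ ã₂ d b∉ã b∉M b∈N) (e-ν e) =
    let _ , Q≡ , e₁ = unabstr-process (b ∷ []) A e
    in backward-OPEN ã₁ ã₂ (backward d e₁) b∉ã b∉M b∈N Q≡
  backward (Ψ.ALPHA d a∈ s b∉M b∉N b#) e = backward-ALPHA (backward d e) a∈ s b∉M b∉N b#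

  -- The encoding of pi processes

  -- The agent encoding P; the pattern of an input lists the bound positions in order.
  ⟪_⟫ : Pi V → Agent V
  ⟪ 𝟎 ⟫            = case []
  ⟪ input′ x Δ P ⟫ = input′ (name x) Δ (permutedPattern Perm.id) ⟪ P ⟫
  ⟪ output x ỹ P ⟫ = output (name x) ⟨ ỹ ⟩ ⟪ P ⟫
  ⟪ match a b P ⟫  = case ((a ≐ b , ⟪ P ⟫) ∷ [])
  ⟪ ν′ s P ⟫       = ν′ s ⟪ P ⟫
  ⟪ ! P ⟫          = ! ⟪ P ⟫
  ⟪ P ∣ Q ⟫        = ⟪ P ⟫ ∣ ⟪ Q ⟫
  ⟪ P ⊕ Q ⟫        = case ((⊤ᶜ , ⟪ P ⟫) ∷ (⊤ᶜ , ⟪ Q ⟫) ∷ [])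

  ⟪⟫-Guarded : ∀ (P : Pi V) → Guarded ⟪ P ⟫
  ⟪⟫-Guarded 𝟎              = g-case []
  ⟪⟫-Guarded (input′ x Δ P) = g-input
  ⟪⟫-Guarded (output x ỹ P) = g-output
  ⟪⟫-Guarded (match a b P)  = g-case (⟪⟫-Guarded P ∷ [])
  ⟪⟫-Guarded (ν′ s P)       = g-ν (⟪⟫-Guarded P)
  ⟪⟫-Guarded (! P)          = g-rep (⟪⟫-Guarded P)
  ⟪⟫-Guarded (P ∣ Q)        = g-par (⟪⟫-Guarded P) (⟪⟫-Guarded Q)
  ⟪⟫-Guarded (P ⊕ Q)        = g-case (⟪⟫-Guarded P ∷ ⟪⟫-Guarded Q ∷ [])

  mapAgent-map₁-id : ∀ {n} (A : Agent (Fin n ⊎ V)) → Ψ.mapAgent (Sum.map₁ id) A ≡ A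
  mapAgent-map₁-id A = mapAgent-fixed A λ { {inj₁ _} _ → refl ; {inj₂ _} _ → refl }

  ⟪⟫-Enc : ∀ {P : Pi V} → WellSorted srt P → Enc m srt P ⟪ P ⟫
  ⟪⟫-Enc ws-𝟎 = e-nil
  ⟪⟫-Enc (ws-input {Δ = Δ} {P} o w) =
    e-input Perm.id identity o (sym (Vec.tabulate∘lookup Δ)) refl
      (sym (mapAgent-map₁-id ⟪ P ⟫)) (⟪⟫-Enc w)
  ⟪⟫-Enc (ws-output o w)      = e-output o (⟪⟫-Enc w)
  ⟪⟫-Enc (ws-match {P = P} w) = e-match (⟪⟫-Guarded P) (⟪⟫-Enc w)
  ⟪⟫-Enc (ws-ν w)             = e-ν (⟪⟫-Enc w)
  ⟪⟫-Enc (ws-rep {P} w)       = e-rep (⟪⟫-Guarded P) (⟪⟫-Enc w)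
  ⟪⟫-Enc (ws-par w v)         = e-par (⟪⟫-Enc w) (⟪⟫-Enc v)
  ⟪⟫-Enc (ws-sum {P} {Q} w v) = e-sum (⟪⟫-Guarded P) (⟪⟫-Guarded Q) (⟪⟫-Enc w) (⟪⟫-Enc v)

  canonical-unique : ∀ {P : Pi V} {A} → Enc canonical srt P A → A ≡ ⟪ P ⟫
  canonical-unique e-nil = refl
  canonical-unique (e-input {Δ = Δ} {B = B} _ identity _ refl refl refl e) =
    cong₂ (λ Δ → input′ (name _) Δ _) (Vec.tabulate∘lookup Δ)
      (trans (mapAgent-map₁-id B) (canonical-unique e))
  canonical-unique (e-output _ e)    = cong (output _ _) (canonical-unique e)
  canonical-unique (e-match _ e)     = cong (λ A → case ((_ , A) ∷ [])) (canonical-unique e)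
  canonical-unique (e-ν e)           = cong (ν′ _) (canonical-unique e)
  canonical-unique (e-rep _ e)       = cong !_ (canonical-unique e)
  canonical-unique (e-par e f)       = cong₂ _∣_ (canonical-unique e) (canonical-unique f)
  canonical-unique (e-sum _ _ e f)   =
    cong₂ (λ A B → case ((⊤ᶜ , A) ∷ (⊤ᶜ , B) ∷ [])) (canonical-unique e) (canonical-unique f)

  ⟪⟫-map : {srtV : V → Subject} {srtW : W → Subject} (f : V → W) →
           (∀ v → srtW (f v) ≡ srtV v) → ∀ {P} → WellSorted srtV P →
           ⟪ Π.mapPi f P ⟫ ≡ Ψ.mapAgent f ⟪ P ⟫
  ⟪⟫-map {srtW = srtW} f h w = sym (canonical-unique {srt = srtW} (Enc-map f h (⟪⟫-Enc w)))

  -- The encoding on well-sorted processes.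
  ⟦_⟧ : Π.Process → Ψ.Process
  ⟦ Π.process P w ⟧ = Ψ.process ⟪ P ⟫ (Enc-WF (⟪⟫-Enc {m = canonical} w))

  -- Corresponding actions; the order of bound names is immaterial, as the equality of pi
  -- actions requires.
  infix 4 _≊_

  data _≊_ : Π.Act → Ψ.Act → Set where
    out : ∀ {x̃ ã z ỹ} → x̃ ↭ ã → Π.out x̃ z ỹ ≊ Ψ.out (name z) ã ⟨ ỹ ⟩
    inp : ∀ {x z̃} → Π.inp x z̃ ≊ Ψ.inp (name x) ⟨ z̃ ⟩
    τ   : Π.τ ≊ Ψ.τ

  ≊-⌈⌉ : ∀ β → β ≊ ⌈ β ⌉
  ≊-⌈⌉ (Π.out x̃ z ỹ) = out ↭-refl
  ≊-⌈⌉ (Π.inp x z̃)   = inp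
  ≊-⌈⌉ Π.τ           = τ

  ≊-resp : ∀ {β β′ α} → β Π.≈ₐ β′ → β ≊ α → β′ ≊ α
  ≊-resp (Π.out p) (out q) = out (↭-trans (↭-sym p) q)
  ≊-resp Π.inp     inp     = inp
  ≊-resp Π.τ       τ       = τ

  ≊-equivariant : ∀ π {β α} → β ≊ α → Π.swapAct π β ≊ Ψ.mapAct (act π) α
  ≊-equivariant π (out p) = out (↭.map⁺ (act π) p)
  ≊-equivariant π inp     = inp
  ≊-equivariant π τ       = τ

  -- The context of each process constructor.
  ctx : ∀ {k} → Π.Op k → Ψ.Ctx k
  ctx Π.𝟎                = Ψ.Ctx.case Ψ.[]
  ctx (Π.inputᵒ x ỹ _ _) = Ψ.inputᶜ (name x) ỹ (toList ỹ) Ψ.hole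
  ctx (Π.output x ỹ _)   = Ψ.output (name x) ⟨ ỹ ⟩ Ψ.hole
  ctx (Π.match a b)      = Ψ.Ctx.case ((a ≐ b) Ψ.∶ Ψ.hole ∷ Ψ.[])
  ctx (Π.νᵒ x)           = Ψ.νᶜ x Ψ.hole
  ctx Π.rep              = Ψ.! Ψ.hole
  ctx Π.par              = Ψ.hole Ψ.∣ Ψ.hole
  ctx Π.sum              = Ψ.Ctx.case (⊤ᶜ Ψ.∶ Ψ.hole ∷ (⊤ᶜ Ψ.∶ Ψ.hole ∷ Ψ.[]))

  ctx-equivariant : ∀ {k} π (f : Π.Op k) → ctx (Π.swapOp π f) ≡ Ψ.mapCtx (act π) (ctx f)
  ctx-equivariant π Π.𝟎                = refl
  ctx-equivariant π (Π.inputᵒ x ỹ _ _) =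
    cong (λ X → Ψ.inputᶜ (name (act π x)) (Vec.map (act π) ỹ) X Ψ.hole) (Vec.toList-map (act π) ỹ)
  ctx-equivariant π (Π.output x ỹ _)   = refl
  ctx-equivariant π (Π.match a b)      = refl
  ctx-equivariant π (Π.νᵒ x)           = refl
  ctx-equivariant π Π.rep              = refl
  ctx-equivariant π Π.par              = refl
  ctx-equivariant π Π.sum              = refl

  compositional : ∀ {k} (f : Π.Op k) (P̃ : Vec Π.Process k) →
    Ψ.agent ⟦ Π.build f P̃ ⟧ ≡ Ψ.plug (ctx f) (Vec.map (Ψ.agent ∘ ⟦_⟧) P̃)
  compositional Π.𝟎 [] = refl
  compositional (Π.inputᵒ x ỹ u _) (Π.process P w ∷ []) =
    cong₂ (input′ (name x) (Vec.map sort ỹ)) binders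
      (⟪⟫-map {srtW = ext (Vec.map sort ỹ) sort} (abstr ỹ) (abstr-sort ỹ) w)
    where
    binders : permutedPattern Perm.id ≡ List.map (abstr ỹ) (toList ỹ)
    binders = trans (sym (abstr-pattern Perm.id u))
      (cong (λ x̃ → List.map (abstr x̃) (toList ỹ)) (Vec.tabulate∘lookup ỹ))
  compositional (Π.output x ỹ _) (_ ∷ []) = refl
  compositional (Π.match a b)    (_ ∷ []) = refl
  compositional (Π.νᵒ x) (Π.process P w ∷ []) =
    cong (ν′ (sort x)) 
      (⟪⟫-map {srtW = ext (sort x ∷ []) sort} (abstr (x ∷ [])) (abstr-sort (x ∷ [])) w)
  compositional Π.rep (_ ∷ [])     = refl
  compositional Π.par (_ ∷ _ ∷ []) = refl
  compositional Π.sum (_ ∷ _ ∷ []) = refl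

  forth : ∀ {P β P′} → Π.term P Π.-[ β ]→ Π.term P′ →
    Σ[ α ∈ Ψ.Act ] Σ[ Q ∈ Ψ.Process ]
      Ψ.agent ⟦ P ⟧ Ψ.-[ α ]→ Ψ.agent Q × Ψ.agent ⟦ P′ ⟧ Ψ.≡ₛ Ψ.agent Q × β ≊ α
  forth {P} {β} {P′} d with forward d (⟪⟫-Enc {m = canonical} (Π.wellSorted P))
  ... | _ , d′ , e with refl ← canonical-unique e =
    ⌈ β ⌉ , ⟦ P′ ⟧ , d′ , Ψ.≡-refl , ≊-⌈⌉ β

  back : ∀ {P α} {Q : Ψ.Process} → Ψ.agent ⟦ P ⟧ Ψ.-[ α ]→ Ψ.agent Q →
    Σ[ β ∈ Π.Act ] Σ[ P′ ∈ Π.Process ]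
      Π.term P Π.-[ β ]→ Π.term P′ × Ψ.agent ⟦ P′ ⟧ Ψ.≡ₛ Ψ.agent Q × β ≊ α
  back {P} d with backward d (⟪⟫-Enc {m = canonical} (Π.wellSorted P))
  ... | β , P′ , refl , d′ , e =
    β , Π.process P′ (Enc-WellSorted e) , d′
    , subst (⟪ P′ ⟫ Ψ.≡ₛ_) (sym (canonical-unique e)) Ψ.≡-refl , ≊-⌈⌉ β

  represents : Representation sortedPolyadicPi
  represents = record
    { ⟦_⟧            = ⟦_⟧
    ; ⟦⟧-cong        = cong ⟪_⟫
    ; ⟦⟧-equivariant = λ π P → ⟪⟫-map {srtW = sort} (act π) (act-sort π) (Π.wellSorted P)
    ; _≊_            = _≊_
    ; ≊-resp         = ≊-resp
    ; ≊-equivariant  = ≊-equivariant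
    ; ctx            = ctx
    ; ctx-equivariant = ctx-equivariant
    ; compositional  = compositional
    ; forth          = λ {P} {_} {P′} → forth {P} {_} {P′}
    ; back           = λ {P} {_} {Q} → back {P} {_} {Q}
    }

  -- Completeness

  -- An inert process below a binder, with the bound names discarded.
  strengthen : ∀ {n} {D : Pi (Fin n ⊎ V)} → Inert D →
               Σ[ E ∈ Pi V ] Inert E ×
                 (∀ v → (v Π.∈fn E → inj₂ v Π.∈fn D) × (inj₂ v Π.∈fn D → v Π.∈fn E))
  strengthen nil = 𝟎 , nil , λ _ → id , id
  strengthen (stuck {v = inj₁ i}) =
    𝟎 , nil , λ _ → (λ ()) , λ { (inj₂ (inj₁ ())) }
  strengthen (stuck {s} {inj₂ v}) =
    ν′ s (match (inj₁ zero) (inj₂ v) 𝟎) , stuck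
    , λ _ → (λ { (inj₂ (inj₁ refl)) → inj₂ (inj₁ refl) })
          , (λ { (inj₂ (inj₁ refl)) → inj₂ (inj₁ refl) })
  strengthen (i ⊕ j) with strengthen i | strengthen j
  ... | E , i′ , s | F , j′ , t =
    E ⊕ F , i′ ⊕ j′ , λ v → Sum.map (proj₁ (s v)) (proj₁ (t v)) , Sum.map (proj₂ (s v)) (proj₂ (t v))

  -- An inert process whose only free name is v.  The sort of the bound name is arbitrary;
  -- that of v is at hand.
  inertFor : (V → Subject) → V → Pi V
  inertFor srt v = ν′ (srt v) (match (inj₁ zero) (inj₂ v) 𝟎)

  -- An inert process with the free names of P.
  silence : (srt : V → Subject) (P : Pi V) → Σ[ D ∈ Pi V ] Inert D × SameNames D P
  silence srt 𝟎 = 𝟎 , nil , λ _ → id , id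
  silence srt (input′ x Δ P) with silence (ext Δ srt) P
  ... | _ , i , s with strengthen i
  ...   | E , j , t = inertFor srt x ⊕ E , stuck ⊕ j , λ v →
    Sum.map (λ { (inj₂ (inj₁ refl)) → refl }) (proj₁ (s (inj₂ v)) ∘ proj₁ (t v)) ,
    Sum.map (λ { refl → inj₂ (inj₁ refl) }) (proj₂ (t v) ∘ proj₂ (s (inj₂ v)))
  silence srt (output x ỹ P) with silence srt P | list ỹ
    where
    list : (ỹ : List _) → Σ[ D ∈ Pi _ ] Inert D ×
           (∀ v → (v Π.∈fn D → v ∈ ỹ) × (v ∈ ỹ → v Π.∈fn D))
    list []      = 𝟎 , nil , λ _ → (λ ()) , (λ ())
    list (y ∷ ỹ) with list ỹ
    ... | D , i , s = inertFor srt y ⊕ D , stuck ⊕ i , λ v →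
      (λ { (inj₁ (inj₂ (inj₁ refl))) → here refl ; (inj₂ p) → there (proj₁ (s v) p) }) ,
      (λ { (here refl) → inj₁ (inj₂ (inj₁ refl)) ; (there p) → inj₂ (proj₂ (s v) p) })
  ... | D , i , s | E , j , t = inertFor srt x ⊕ E ⊕ D , stuck ⊕ j ⊕ i , λ v →
    Sum.map (λ { (inj₂ (inj₁ refl)) → refl }) (Sum.map (proj₁ (t v)) (proj₁ (s v))) ,
    Sum.map (λ { refl → inj₂ (inj₁ refl) }) (Sum.map (proj₂ (t v)) (proj₂ (s v)))
  silence srt (match a b P) with silence srt P
  ... | D , i , s = inertFor srt a ⊕ inertFor srt b ⊕ D , stuck ⊕ stuck ⊕ i , λ v →
    Sum.map (λ { (inj₂ (inj₁ refl)) → refl })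
      (Sum.map (λ { (inj₂ (inj₁ refl)) → refl }) (proj₁ (s v))) ,
    Sum.map (λ { refl → inj₂ (inj₁ refl) })
      (Sum.map (λ { refl → inj₂ (inj₁ refl) }) (proj₂ (s v)))
  silence srt (ν′ s P) with silence (ext (s ∷ []) srt) P
  ... | _ , i , u with strengthen i
  ...   | E , j , t = E , j , λ v → proj₁ (u (inj₂ v)) ∘ proj₁ (t v) , proj₂ (t v) ∘ proj₂ (u (inj₂ v))
  silence srt (! P) = silence srt P
  silence srt (P ∣ Q) with silence srt P | silence srt Q
  ... | D , i , s | E , j , t = D ⊕ E , i ⊕ j , λ v →
    Sum.map (proj₁ (s v)) (proj₁ (t v)) , Sum.map (proj₂ (s v)) (proj₂ (t v))
  silence srt (P ⊕ Q) with silence srt P | silence srt Q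
  ... | D , i , s | E , j , t = D ⊕ E , i ⊕ j , λ v →
    Sum.map (proj₁ (s v)) (proj₁ (t v)) , Sum.map (proj₂ (s v)) (proj₂ (t v))

  -- A well-formed pattern lists the bound positions in some order.
  pattern-enumerates : ∀ {n} {X : Ψ.Pattern (Fin n ⊎ V)} →
    Σ[ is ∈ List (Fin n) ] X ≡ List.map inj₁ is × ListUnique.Unique is × (∀ i → i ∈ is) →
    Σ[ ρ ∈ Permutation′ n ] X ≡ permutedPattern ρ
  pattern-enumerates (is , refl , u , all) with enumeration u all
  ... | ρ , refl = ρ , trans (List.map-tabulate (ρ ⟨$⟩ˡ_) inj₁) (sym (toList-tabulate _))

  -- Every well-formed agent encodes some pi process.
  decode : ∀ {A : Agent V} → WF srt A → Σ[ P ∈ Pi V ] Enc liberal srt P A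
  decodeᵇ : ∀ {bs : List (Cond V × Agent V)} → All (λ b → WF srt (proj₂ b) × Guarded (proj₂ b)) bs →
            Σ[ P ∈ Pi V ] Enc liberal srt P (case bs)
  decode (wf-output {N = name _} () w)
  decode (wf-output {N = ⟨ ỹ ⟩} (Ψ.carries o) w) with decode w
  ... | P , e = output _ ỹ P , e-output o e
  decode {srt = srt} (wf-input {Δ = Δ} {P = A} (Ψ.carries o) pos w)
    with pattern-enumerates pos | decode w
  ... | ρ , refl | P , e =
    input′ _ Δ′ (Π.mapPi (Sum.map₁ (ρ ⟨$⟩ʳ_)) P)
    , e-input ρ any (trans o (cong just sorts)) (sym (·-flip ρ Δ)) refl (sym (mapAgent-flip ρ A))
        (Enc-map (Sum.map₁ (ρ ⟨$⟩ʳ_)) (ext-· (flip ρ) Δ) e)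
    where
    Δ′ : Vec Subject _
    Δ′ = flip ρ · Δ
    sorts : List.map (ext Δ srt) (permutedPattern ρ) ≡ toList Δ′
    sorts = trans (cong (λ Δ → List.map (ext Δ srt) (permutedPattern ρ)) (sym (·-flip ρ Δ)))
                  (pattern-sorts ρ Δ′ srt)
  decode (wf-case ws) = decodeᵇ ws
  decode (wf-ν w) with decode w
  ... | P , e = ν′ _ P , e-ν e
  decode (wf-par w v) with decode w | decode v
  ... | P , e | Q , f = P ∣ Q , e-par e f
  decode (wf-rep w g) with decode w
  ... | P , e = ! P , e-rep g e
  decode wf-assert = 𝟎 , e-assert
  decodeᵇ [] = 𝟎 , e-nil
  decodeᵇ {srt = srt} {bs = (φ , _) ∷ _} ((w , g) ∷ ws) with decode w | decodeᵇ ws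
  ... | P , e | Q , f = branchFor φ
    where
    branchFor : ∀ φ → Σ[ R ∈ Pi _ ] Enc liberal srt R (case ((φ , _) ∷ _))
    branchFor ⊤ᶜ      = P ⊕ Q , e-⊤ g e f
    branchFor ⊥ᶜ      with silence srt P
    ... | D , i , s   = D ⊕ Q , e-⊥ g e i s f
    branchFor (a ≐ b) = match a b P ⊕ Q , e-≐ g e f

  -- Agents which encode a common pi process.
  Similar : Ψ.Process → Ψ.Process → Set
  Similar A B = Σ[ P ∈ Pi Name ] Enc liberal sort P (Ψ.agent A) × Enc liberal sort P (Ψ.agent B)

  Similar-bisimulation : Ψ.Bisimulation Similar
  Similar-bisimulation = record
    { symmetric = λ { (P , e , f) → P , f , e }
    ; simulates = λ {A} {B} {_} {A′} → simulates {A} {B} {_} {A′}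
    }
    where
    simulates : ∀ {A B α A′} → Similar A B → All (Ψ._# Ψ.agent B) (Ψ.bn α) →
                Ψ.agent A Ψ.-[ α ]→ Ψ.agent A′ →
                ∃[ B′ ] Ψ.agent B Ψ.-[ α ]→ Ψ.agent B′ × Similar A′ B′
    simulates (P , e , f) _ d with backward d e
    ... | _ , P′ , refl , d′ , e′ with forward d′ f
    ...   | B′ , d″ , f′ = Ψ.process B′ (Enc-WF f′) , d″ , P′ , e′ , f′

  Similar-⟦⟧* : ∀ {A B} σ̃ → Similar A B → Similar (A Ψ.⟦ σ̃ ⟧*) (B Ψ.⟦ σ̃ ⟧*)
  Similar-⟦⟧* []      s           = s
  Similar-⟦⟧* {A} {B} (σ ∷ σ̃) (P , e , f) =
    Similar-⟦⟧* {A Ψ.⟦ σ ⟧} {B Ψ.⟦ σ ⟧} σ̃ (Π.mapPi (dom := cod) P , Enc-map _ h e , Enc-map _ h f)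
    where
    open Substitution σ
    h : ∀ c → sort ((dom := cod) c) ≡ sort c
    h = :=-sort dom cod same

  complete : ∀ (A : Ψ.Process) → Σ[ P ∈ Π.Process ] A Ψ.∼ ⟦ P ⟧
  complete A with decode (Ψ.wf A)
  ... | P , e = Π.process P w , λ σ̃ →
    Similar , Similar-bisimulation , Similar-⟦⟧* {A} {⟦ Π.process P w ⟧} σ̃ (P , e , ⟪⟫-Enc w)
    where
    w : WellSorted sort P
    w = Enc-WellSorted e

  completelyRepresents : CompleteRepresentation sortedPolyadicPi
  completelyRepresents = record { representation = represents ; complete = complete }

theorem4p12 : (Sig : Signature) → Calculi.CompleteRepresentation Sig (Calculi.sortedPolyadicPi Sig)
theorem4p12 = Encoding.completelyRepresents
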